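{- Let $D$ be a 2-strong digraph of order $n\geq 6$ such that $d(x)+d(y)+d(w)+d(z)\geq 4n-3$ for all distinct pairs $\{x,y\}\neq\{w,z\}$ of non-adjacent vertices of $D$. Suppose that $D$ contains a pair of non-adjacent vertices $x,y$ with $d(x)+d(y)\leq 2n-4$. Then $D$ is pancyclic, i.e. $D$ contains directed cycles of every length $m$ with $3\leq m\leq n$.
   Context: Digraphs are finite, without loops and multiple arcs. For a vertex $x$, $d(x)=d^+(x)+d^-(x)$ is the sum of its out-degree and in-degree. Two distinct vertices $x,y$ are adjacent if $xy\in A(D)$ or $yx\in A(D)$. A digraph is 2-strong if it has at least 3 vertices and remains strongly connected after deleting any single vertex. The length of a cycle is its number of arcs. -}

module Defs where

open import Data.Nat using (ℕ; zero; suc; _+_; _≤_; _<_; s≤s)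
open import Data.Nat.Properties using (_<?_)
open import Data.Fin using (Fin; zero; suc; toℕ; fromℕ<)
open import Data.Bool using (Bool; true; false; if_then_else_)
open import Data.List using (List; map; allFin)
open import Data.Nat.ListAction using (sum)
open import Data.Product using (Σ; _×_)
open import Data.Empty using (⊥)
open import Relation.Nullary using (¬_; yes; no)
open import Relation.Binary.PropositionalEquality using (_≡_; _≢_)
open import Function.Definitions using (Injective)

record Digraph (n : ℕ) : Set where
  field
    arc      : Fin n → Fin n → Bool
    loopless : ∀ x → arc x x ≡ false
open Digraph public

Arc : ∀ {n} → Digraph n → Fin n → Fin n → Set
Arc D x y = arc D x y ≡ true

outdeg : ∀ {n} → Digraph n → Fin n → ℕ
outdeg {n} D x = sum (map (λ y → if arc D x y then 1 else 0) (allFin n))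

indeg : ∀ {n} → Digraph n → Fin n → ℕ
indeg {n} D x = sum (map (λ y → if arc D y x then 1 else 0) (allFin n))

deg : ∀ {n} → Digraph n → Fin n → ℕ
deg D x = outdeg D x + indeg D x

NonAdjacent : ∀ {n} → Digraph n → Fin n → Fin n → Set
NonAdjacent D x y = x ≢ y × ¬ Arc D x y × ¬ Arc D y x

-- Reach D v x z : there is a directed walk from x to z in D − v
-- (x and z are assumed ≠ v by the callers; every later vertex is ≠ v)
data Reach {n} (D : Digraph n) (v : Fin n) : Fin n → Fin n → Set where
  here : ∀ {x} → Reach D v x x
  step : ∀ {x y z} → Arc D x y → y ≢ v → Reach D v y z → Reach D v x z

StrongWithout : ∀ {n} → Digraph n → Fin n → Set
StrongWithout {n} D v = ∀ (x y : Fin n) → x ≢ v → y ≢ v → Reach D v x y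

TwoStrong : ∀ {n} → Digraph n → Set
TwoStrong {n} D = 3 ≤ n × (∀ v → StrongWithout D v)

nextF : ∀ {k} → Fin (suc k) → Fin (suc k)
nextF {k} i with toℕ i <? k
... | yes p = fromℕ< (s≤s p)
... | no _  = zero

HasCycle : ∀ {n} → Digraph n → ℕ → Set
HasCycle D zero = ⊥
HasCycle {n} D (suc k) =
  Σ (Fin (suc k) → Fin n) λ c → Injective _≡_ _≡_ c × (∀ i → Arc D (c i) (c (nextF i)))

Pancyclic : ∀ {n} → Digraph n → Set
Pancyclic {n} D = ∀ m → 3 ≤ m → m ≤ n → HasCycle D m

{-# OPTIONS --safe #-}

-- By the degree condition every pair of non-adjacent vertices other than {x , y} has degree sum at least 2n + 1.
--
-- Lengths below n.  If such a pair exists, one of its vertices z has degree at least n + 1.  A Meyniel-type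
-- argument (insert the vertices bypassed by a detour back into the cycle, and count degrees) shows that D − z
-- has a cycle through all its vertices except possibly x; since z sends and receives more arcs than that cycle
-- has vertices, z closes up segments of it to cycles of every length.  If no such pair exists, D − x is strong
-- and semicomplete, and Moon's theorem applies.
--
-- Length n.  The Meyniel-type argument extends any cycle through both x and y to a Hamiltonian one, so a cycle
-- through x and y suffices.  A vertex z non-adjacent to y has at least five two-arc connections y → w → z or
-- z → w → y.  Were there no cycle through x and y, Menger's theorem would show that an out-neighbour of x has at
-- most one arc to the in-neighbours of y (and symmetrically), so the many connections let x and y exchange
-- their ends of two disjoint paths from the out-neighbours to the in-neighbours of {x , y}.
--
-- Containing a cycle of given length is decidable, so the whole argument derives a contradiction from its absence.
module Submission where

open import Defs
open import Data.Nat using (ℕ; zero; suc; _+_; _*_; _∸_; _≤_; _<_; z≤n; s≤s; s≤s⁻¹)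
open import Data.Nat.Properties hiding (_≟_)
open import Data.Nat.ListAction using (sum)
open import Data.Nat.ListAction.Properties using (sum-++; sum-↭)
open import Data.Nat.Solver using (module +-*-Solver)
open import Data.Fin using (Fin; zero; suc; toℕ; fromℕ<)
open import Data.Fin.Properties using (_≟_; toℕ-fromℕ<; toℕ<n; all?) renaming (any? to anyFin?)
import Data.Bool
open import Data.Bool using (true; false; if_then_else_)
open import Data.List using (List; []; _∷_; _++_; length; map; filter; allFin; lookup)
open import Data.List.Properties using (++-assoc; length-++; map-++; ++-identityʳ; length-tabulate)
open import Data.List.Membership.Propositional using (_∈_; _∉_; find; lose)
open import Data.List.Membership.Propositional.Properties using (∈-++⁺ˡ; ∈-++⁺ʳ; ∈-++⁻; ∈-∃++; ∈-insert; ∈-filter⁺; ∈-filter⁻; ∈-lookup; ∈-length; ∈-allFin)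
open import Data.List.Membership.DecPropositional using () renaming (_∈?_ to mem?)
open import Data.List.Relation.Unary.Any using (here; there; any?)
open import Data.List.Relation.Unary.All.Properties using (¬Any⇒All¬; All¬⇒¬Any)
open import Data.List.Relation.Unary.AllPairs using ([]; _∷_)
open import Data.List.Relation.Unary.Unique.Propositional using (Unique)
open import Data.List.Relation.Unary.Unique.Propositional.Properties using (Unique[x∷xs]⇒x∉xs) renaming (++⁺ to Unique-++⁺; filter⁺ to Unique-filter⁺; allFin⁺ to Unique-allFin⁺)
open import Data.List.Relation.Binary.Permutation.Propositional using (_↭_; ↭-sym; ↭-trans; ↭-refl; ↭-reflexive; prep; swap)
open import Data.List.Relation.Binary.Permutation.Propositional.Properties using (∈-resp-↭; ↭-length; shift; All-resp-↭) renaming (map⁺ to ↭-map⁺; ++-comm to ↭-++-comm; ++⁺ˡ to ↭-++⁺ˡ; ++⁺ʳ to ↭-++⁺ʳ)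
open import Data.List.Relation.Unary.All using ([]; _∷_)
open import Data.Vec as Vec using (Vec; []; _∷_)
open import Data.Vec.Properties using (lookup∘tabulate)
open import Data.Product using (Σ; _×_; _,_; ∃; proj₁; proj₂)
open import Data.Sum using (_⊎_; inj₁; inj₂) renaming (map₂ to ⊎-map₂; swap to ⊎-swap)
open import Data.Unit using (⊤; tt)
open import Data.Empty using (⊥; ⊥-elim)
open import Function using (_∘_; id)
open import Relation.Nullary using (¬_; Dec; yes; no)
open import Relation.Nullary.Decidable using (_⊎-dec_; _×-dec_; _→-dec_; ¬?)
open import Relation.Binary.PropositionalEquality using (_≡_; _≢_; refl; sym; trans; cong; cong₂; subst; subst₂)

-- Lists and walks

-- The obstacle is the pair {x, y} itself: its degree sum is the only one not bounded below, all
-- others being at least (4n - 3) - (2n - 4) = 2n + 1. The degree counting must never be applied to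
-- it, and two devices ensure this. A predicate `M` exempts at most one vertex, which an enlargement
-- of a cycle may drop or pick up freely; for D - z this vertex is x. A predicate `K` marks vertices
-- that every cycle considered keeps; with K = {x, y}, a vertex missing from the cycle is neither x
-- nor y, which serves length n. The exempt vertex may carry more arcs than the counting allows, so
-- each use of it has to be paid for by an arc known to be absent elsewhere. Deleting z leaves
-- almost no slack: in D - z, of order N, non-adjacent pairs have degree sum at least 2N - 1, and
-- the counts end at 2N - 2.

_∈?_ : ∀ {n} (v : Fin n) (l : List (Fin n)) → Dec (v ∈ l)
_∈?_ = mem? _≟_

-- Classical case distinction, available because the goal is `⊥`; no decidability of `P` has to be
-- established.
by-cases : ∀ {P : Set} → (P → ⊥) → ((P → ⊥) → ⊥) → ⊥
by-cases f g = g f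

module _ {V : Set} where

  ∉-∷ : ∀ {v u : V} {l} → v ≢ u → v ∉ l → v ∉ u ∷ l
  ∉-∷ ne _ (here e) = ne e
  ∉-∷ _ nl (there m) = nl m

  ∉-++ : ∀ {v : V} l₁ {l₂} → v ∉ l₁ → v ∉ l₂ → v ∉ l₁ ++ l₂
  ∉-++ l₁ n₁ n₂ m with ∈-++⁻ l₁ m
  ... | inj₁ a = n₁ a
  ... | inj₂ b = n₂ b

  ∈-singleton : ∀ {v u : V} → v ∈ u ∷ [] → v ≡ u
  ∈-singleton (here e) = e

  Unique-∷ : ∀ {v : V} {l} → v ∉ l → Unique l → Unique (v ∷ l)
  Unique-∷ nv u = ¬Any⇒All¬ _ nv ∷ u

  Unique-tail : ∀ {v : V} {l} → Unique (v ∷ l) → Unique l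
  Unique-tail (_ ∷ u) = u

  Unique-++⁻ : ∀ (l₁ : List V) {l₂} → Unique (l₁ ++ l₂) →
               Unique l₁ × Unique l₂ × (∀ {v} → v ∈ l₁ → v ∉ l₂)
  Unique-++⁻ [] u = [] , u , λ ()
  Unique-++⁻ (x ∷ l₁) (a ∷ u) with Unique-++⁻ l₁ u
  ... | u₁ , u₂ , d = Unique-∷ (λ m → All¬⇒¬Any a (∈-++⁺ˡ m)) u₁ , u₂ ,
        λ { (here refl) m → All¬⇒¬Any a (∈-++⁺ʳ l₁ m) ; (there q) m → d q m }

  Unique-split : ∀ (l₁ : List V) {v l₂} → Unique (l₁ ++ v ∷ l₂) → v ∉ l₁ × v ∉ l₂
  Unique-split l₁ u with Unique-++⁻ l₁ u
  ... | _ , u₂ , d = (λ m → d m (here refl)) , Unique[x∷xs]⇒x∉xs u₂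

  Unique-resp-↭ : ∀ {l l' : List V} → l ↭ l' → Unique l → Unique l'
  Unique-resp-↭ _↭_.refl u = u
  Unique-resp-↭ (prep x p) (a ∷ u) = All-resp-↭ p a ∷ Unique-resp-↭ p u
  Unique-resp-↭ (swap x y p) ((x≢y ∷ a) ∷ (b ∷ u)) =
    ((x≢y ∘ sym) ∷ All-resp-↭ p b) ∷ (All-resp-↭ p a ∷ Unique-resp-↭ p u)
  Unique-resp-↭ (_↭_.trans p q) u = Unique-resp-↭ q (Unique-resp-↭ p u)

module _ {V : Set} where

  data Path (E : V → V → Set) : V → List V → V → Set where
    one : ∀ {u} → Path E u (u ∷ []) u
    _◂_ : ∀ {u v l w} → E u v → Path E v l w → Path E u (u ∷ l) w

  infixr 5 _◂_

  module _ {E : V → V → Set} where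

    join : ∀ {u l v v' l' w} → Path E u l v → E v v' → Path E v' l' w → Path E u (l ++ l') w
    join one e q = e ◂ q
    join (f ◂ p) e q = f ◂ join p e q

    splitPath : ∀ {u} l₁ {v l₂ w} → Path E u (l₁ ++ v ∷ l₂) w →
                Path E u (l₁ ++ v ∷ []) v × Path E v (v ∷ l₂) w
    splitPath [] one = one , one
    splitPath [] (e ◂ p) = one , e ◂ p
    splitPath (x ∷ []) (e ◂ p) with splitPath [] p
    ... | a , b = e ◂ a , b
    splitPath (x ∷ y ∷ l₁) (e ◂ p) with splitPath (y ∷ l₁) p
    ... | a , b = e ◂ a , b

    first∈ : ∀ {u l w} → Path E u l w → u ∈ l
    first∈ one = here refl
    first∈ (_ ◂ _) = here refl

    last∈ : ∀ {u l w} → Path E u l w → w ∈ l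
    last∈ one = here refl
    last∈ (_ ◂ p) = there (last∈ p)

    head≡ : ∀ {u v l w} → Path E u (v ∷ l) w → u ≡ v
    head≡ one = refl
    head≡ (_ ◂ _) = refl

    consecutive : ∀ {u} l₁ {v v' l₂ w} → Path E u (l₁ ++ v ∷ v' ∷ l₂) w →
                  Path E u (l₁ ++ v ∷ []) v × E v v' × Path E v' (v' ∷ l₂) w
    consecutive l₁ p with splitPath l₁ p
    ... | a , (e ◂ q) with head≡ q
    ... | refl = a , e , q

    initPath : ∀ {u s} t l → Path E u (t ∷ l ++ s ∷ []) s → ∃ λ h → Path E u (t ∷ l) h × E h s
    initPath t [] (e ◂ one) = t , one , e
    initPath t (t' ∷ l) (e ◂ q) with initPath t' l q
    ... | h , r , f = h , e ◂ r , f

  mapPath : ∀ {E E' : V → V → Set} → (∀ {a b} → E a b → E' a b) →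
            ∀ {u l w} → Path E u l w → Path E' u l w
  mapPath f one = one
  mapPath f (e ◂ p) = f e ◂ mapPath f p

  reversePath : ∀ {E : V → V → Set} {u l w} → Path E u l w →
                ∃ λ l' → Path (λ a b → E b a) w l' u × (∀ {v} → v ∈ l' → v ∈ l)
  reversePath one = _ , one , id
  reversePath {u = u} (e ◂ p) with reversePath p
  ... | l' , q , sub = l' ++ u ∷ [] , join q e one , grow
    where
    grow : ∀ {v} → v ∈ l' ++ u ∷ [] → v ∈ u ∷ _
    grow m with ∈-++⁻ l' m
    ... | inj₁ a = there (sub a)
    ... | inj₂ b = here (∈-singleton b)

simple : ∀ {n} {E : Fin n → Fin n → Set} {u l w} → Path E u l w →
         ∃ λ l' → Path E u l' w × Unique l' × (∀ {v} → v ∈ l' → v ∈ l)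
simple one = _ , one , [] ∷ [] , id
simple {u = u} (e ◂ p) with simple p
... | l' , q , un , sub with u ∈? l'
...   | no u∉ = u ∷ l' , e ◂ q , Unique-∷ u∉ un ,
        λ { (here r) → here r ; (there m) → there (sub m) }
...   | yes u∈ with ∈-∃++ u∈
...     | l₁ , l₂ , refl = u ∷ l₂ , proj₂ (splitPath l₁ q) , proj₁ (proj₂ (Unique-++⁻ l₁ un)) ,
          λ m → there (sub (∈-++⁺ʳ l₁ m))

Σ[_] : ∀ {V : Set} → (V → ℕ) → List V → ℕ
Σ[ f ] l = sum (map f l)

module _ {V : Set} where

  Σ-++ : ∀ (f : V → ℕ) l₁ l₂ → Σ[ f ] (l₁ ++ l₂) ≡ Σ[ f ] l₁ + Σ[ f ] l₂
  Σ-++ f l₁ l₂ = trans (cong sum (map-++ f l₁ l₂)) (sum-++ (map f l₁) (map f l₂))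

  Σ-↭ : ∀ (f : V → ℕ) {l₁ l₂} → l₁ ↭ l₂ → Σ[ f ] l₁ ≡ Σ[ f ] l₂
  Σ-↭ f p = sum-↭ (↭-map⁺ f p)

  Σ-+ : ∀ (f g : V → ℕ) l → Σ[ (λ v → f v + g v) ] l ≡ Σ[ f ] l + Σ[ g ] l
  Σ-+ f g [] = refl
  Σ-+ f g (x ∷ l) rewrite Σ-+ f g l =
    solve 4 (λ a b c d → a :+ b :+ (c :+ d) := (a :+ c) :+ (b :+ d)) refl (f x) (g x) (Σ[ f ] l) (Σ[ g ] l)
    where open +-*-Solver

  Σ-mono : ∀ (f g : V → ℕ) l → (∀ {v} → v ∈ l → f v ≤ g v) → Σ[ f ] l ≤ Σ[ g ] l
  Σ-mono f g [] h = z≤n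
  Σ-mono f g (x ∷ l) h = +-mono-≤ (h (here refl)) (Σ-mono f g l (h ∘ there))

  Σ-const : ∀ k (l : List V) → Σ[ (λ _ → k) ] l ≡ length l * k
  Σ-const k [] = refl
  Σ-const k (x ∷ l) = cong (k +_) (Σ-const k l)

  Σ-bound : ∀ (f : V → ℕ) k l → (∀ {v} → v ∈ l → f v ≤ k) → Σ[ f ] l ≤ length l * k
  Σ-bound f k l h = subst (Σ[ f ] l ≤_) (Σ-const k l) (Σ-mono f (λ _ → k) l h)

  Σ-zero : ∀ (f : V → ℕ) l → (∀ {v} → v ∈ l → f v ≡ 0) → Σ[ f ] l ≡ 0
  Σ-zero f [] h = refl
  Σ-zero f (x ∷ l) h = cong₂ _+_ (h (here refl)) (Σ-zero f l (h ∘ there))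

-- Two disjoint paths

ABWalk : ∀ {V : Set} → (V → V → Set) → (V → Set) → (V → Set) → List V → Set
ABWalk E A B l = ∃ λ u → ∃ λ w → A u × B w × Path E u l w

Disj : ∀ {V : Set} → List V → List V → Set
Disj l₁ l₂ = ∀ {v} → v ∈ l₁ → v ∉ l₂

-- Menger's theorem for two paths.  The invariant is a fan of two disjoint A-walks meeting in a vertex p
-- together with a path from p to B; a walk avoiding p moves p strictly closer to B.
module Menger {n} (E : Fin n → Fin n → Set) (A B : Fin n → Set)
              (walk : ∀ p → ∃ λ l → ABWalk E A B l × p ∉ l) where

  private
    V = Fin n

    -- Arr t ε : a walk starting in A and ending in t, with earlier vertices ε listed backwards.
    data Arr : V → List V → Set where
      start : ∀ {t} → A t → Arr t []
      _▸_   : ∀ {s t ε} → Arr s ε → E s t → Arr t (s ∷ ε)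

    close : ∀ {t ε l w} → Arr t ε → Path E t l w → B w →
            ∃ λ l' → ABWalk E A B l' × (∀ {v} → v ∈ l' → v ∈ ε ⊎ v ∈ l)
    close (start a) p b = _ , (_ , _ , a , b , p) , inj₂
    close (arr ▸ e) p b with close arr (e ◂ p) b
    ... | l' , wk , sub = l' , wk , λ m → shuffle (sub m)
      where
      shuffle : ∀ {v s ε l} → v ∈ ε ⊎ v ∈ s ∷ l → v ∈ s ∷ ε ⊎ v ∈ l
      shuffle (inj₁ m) = inj₁ (there m)
      shuffle (inj₂ (here r)) = inj₁ (here r)
      shuffle (inj₂ (there m)) = inj₂ m

    advance : ∀ {p o} ρ₁ {s ρ₂ w} → Arr p o → Path E p (p ∷ ρ₁ ++ s ∷ ρ₂) w →
              ∃ λ o' → Arr s o' × (∀ {v} → v ∈ o' → v ∈ p ∷ ρ₁ ⊎ v ∈ o)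
    advance [] arr (e ◂ q) with head≡ q
    ... | refl = _ , arr ▸ e , λ { (here r) → inj₁ (here r) ; (there m) → inj₂ m }
    advance (r ∷ ρ₁) arr (e ◂ q) with head≡ q
    ... | refl with advance ρ₁ (arr ▸ e) q
    ...   | o' , arr' , sub = o' , arr' , λ m → shuffle (sub m)
      where
      shuffle : ∀ {v p r ρ o} → v ∈ r ∷ ρ ⊎ v ∈ p ∷ o → v ∈ p ∷ r ∷ ρ ⊎ v ∈ o
      shuffle (inj₁ m) = inj₁ (there m)
      shuffle (inj₂ (here e)) = inj₁ (here e)
      shuffle (inj₂ (there m)) = inj₂ m

    retreat : ∀ {t} ε₁ {s ε₂} → Arr t (ε₁ ++ s ∷ ε₂) → Arr s ε₂
    retreat [] (arr ▸ _) = arr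
    retreat (_ ∷ ε₁) (arr ▸ _) = retreat ε₁ arr

    Two : Set
    Two = ∃ λ l₁ → ∃ λ l₂ → ABWalk E A B l₁ × ABWalk E A B l₂ × Disj l₁ l₂

    fan : ∀ k {p ρ w α γ} → length ρ < k → Path E p (p ∷ ρ) w → B w → Unique (p ∷ ρ) →
          Arr p α → Arr p γ → Disj α γ → Disj α (p ∷ ρ) → Disj γ (p ∷ ρ) → Two
    fan (suc k) {p} {ρ} {w} {α} {γ} (s≤s lt) pρ bw un aα aγ αγ αρ γρ with walk p
    ... | T , (t₀ , w' , a₀ , bw' , pT) , p∉T =
        arrive pT p∉T (start a₀) aα inj₁ αρ (λ ()) (λ ())
      where
      -- `e` is the part of an arm or of the walk behind `t`, and `o` is the arm of the fan left for
      -- the second path. If `t` lies on an arm, the front of that arm replaces what was travelled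
      -- so far, and the other arm becomes `o`. If `t` lies on `ρ`, it is the meeting vertex of a
      -- new fan: `o` is extended along `ρ` up to `t`.
      arrive : ∀ {t T e o} → Path E t T w' → p ∉ T → Arr t e → Arr p o →
               (∀ {v} → v ∈ o → v ∈ α ⊎ v ∈ γ) → Disj o (p ∷ ρ) → Disj e (p ∷ ρ) → Disj e o → Two
      go : ∀ {t T e o} → Path E t T w' → p ∉ T → Arr t e → Arr p o →
           (∀ {v} → v ∈ o → v ∈ α ⊎ v ∈ γ) → Disj o (p ∷ ρ) →
           Disj (t ∷ e) (p ∷ ρ) → Disj (t ∷ e) o → Two

      arrive {t} {T} {e} {o} q p∉ arr aro oαγ oρ eρ eo with t ∈? ρ
      ... | yes t∈ with ∈-∃++ t∈
      ...   | ρ₁ , ρ₂ , refl with advance ρ₁ aro pρ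
      ...     | o' , aro' , sub =
        fan k (≤-trans (s≤s (≤-trans (m≤n+m (length ρ₂) (length ρ₁)) ≤-refl))
                (≤-trans (≤-reflexive (sym (trans (length-++ ρ₁) (+-suc (length ρ₁) (length ρ₂))))) lt))
          (proj₂ (splitPath (p ∷ ρ₁) pρ)) bw (proj₁ (proj₂ (Unique-++⁻ (p ∷ ρ₁) un)))
          arr aro' ee' (λ m m' → eρ m (∈-++⁺ʳ (p ∷ ρ₁) m')) o'ρ
        where
        ee' : Disj e o'
        ee' m m' with sub m'
        ... | inj₁ a = eρ m (∈-++⁺ˡ {xs = p ∷ ρ₁} a)
        ... | inj₂ b = eo m b
        o'ρ : Disj o' (t ∷ ρ₂)
        o'ρ m m' with sub m
        ... | inj₁ a = proj₂ (proj₂ (Unique-++⁻ (p ∷ ρ₁) un)) a m'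
        ... | inj₂ b = oρ b (∈-++⁺ʳ (p ∷ ρ₁) m')
      arrive {t} q p∉ arr aro oαγ oρ eρ eo | no t∉ρ with t ∈? α
      ... | yes t∈ with ∈-∃++ t∈
      ...   | α₁ , α₂ , refl = go q p∉ (retreat α₁ aα) aγ inj₂ γρ
                (λ m → αρ (∈-++⁺ʳ α₁ m)) (λ m → αγ (∈-++⁺ʳ α₁ m))
      arrive {t} q p∉ arr aro oαγ oρ eρ eo | no t∉ρ | no t∉α with t ∈? γ
      ... | yes t∈ with ∈-∃++ t∈
      ...   | γ₁ , γ₂ , refl = go q p∉ (retreat γ₁ aγ) aα inj₁ αρ
                (λ m → γρ (∈-++⁺ʳ γ₁ m)) (λ m m' → αγ m' (∈-++⁺ʳ γ₁ m))
      arrive {t} {o = o} q p∉ arr aro oαγ oρ eρ eo | no t∉ρ | no t∉α | no t∉γ =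
        go q p∉ arr aro oαγ oρ
          (λ { (here refl) (here refl) → p∉ (first∈ q) ; (here refl) (there m) → t∉ρ m ; (there m) → eρ m })
          (λ { (here refl) m' → t∉o m' ; (there m) → eo m })
        where
        t∉o : t ∉ o
        t∉o m with oαγ m
        ... | inj₁ a = t∉α a
        ... | inj₂ b = t∉γ b

      go one p∉ arr aro oαγ oρ tρ to with close arr one bw' | close aro pρ bw
      ... | l₁ , w₁ , s₁ | l₂ , w₂ , s₂ = l₁ , l₂ , w₁ , w₂ , dj
        where
        dj : Disj l₁ l₂
        dj m m' with s₁ m | s₂ m'
        ... | inj₁ a | inj₁ b = to (there a) b
        ... | inj₁ a | inj₂ b = tρ (there a) b
        ... | inj₂ (here refl) | inj₁ b = to (here refl) b
        ... | inj₂ (here refl) | inj₂ b = tρ (here refl) b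
      go (e' ◂ q) p∉ arr aro oαγ oρ tρ to =
        arrive q (p∉ ∘ there) (arr ▸ e') aro oαγ oρ tρ to

  twoPaths : V → ∃ λ l₁ → ∃ λ l₂ → ABWalk E A B l₁ × ABWalk E A B l₂ × Disj l₁ l₂
  twoPaths v with walk v
  ... | l , (u , w , a , b , q) , _ with simple q
  -- The initial fan has two empty arms, since its meeting vertex is itself in `A`.
  ...   | _ , one , un , _ = fan 1 (s≤s z≤n) one b un (start a) (start a) (λ ()) (λ ()) (λ ())
  ...   | _ ∷ ρ , (e ◂ q') , un , _ = fan (suc (length ρ)) ≤-refl (e ◂ q') b un (start a) (start a) (λ ()) (λ ()) (λ ())

-- Cycles through two vertices

module _ {V : Set} {E : V → V → Set} where

  trimStart : ∀ {A : V → Set} → (∀ v → Dec (A v)) → ∀ {u l w v} → Path E u l w → v ∈ l → A v →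
              ∃ λ u' → ∃ λ l' → A u' × Path E u' l' w × (∀ {t} → t ∈ l' → t ∈ l) × (∀ {t} → t ∈ l' → A t → t ≡ u')
  trimStart A? one (here refl) a = _ , _ , a , one , id , λ m _ → ∈-singleton m
  trimStart A? {l = _ ∷ l} (e ◂ p) m a with any? A? l
  ... | yes later with find later
  ...   | v , v∈ , av with trimStart A? p v∈ av
  ...     | u' , l' , au , q , sub , only = u' , l' , au , q , there ∘ sub , only
  trimStart A? (e ◂ p) (here refl) a | no none = _ , _ , a , e ◂ p , id , only
    where
    only : ∀ {t} → t ∈ _ → _ → t ≡ _
    only (here r) _ = r
    only (there m) at = ⊥-elim (none (lose m at))
  trimStart A? (e ◂ p) (there m) a | no none = ⊥-elim (none (lose m a))

  trimEnd : ∀ {B : V → Set} → (∀ v → Dec (B v)) → ∀ {u l w v} → Path E u l w → v ∈ l → B v →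
            ∃ λ w' → ∃ λ l' → B w' × Path E u l' w' × (∀ {t} → t ∈ l' → t ∈ l) × (∀ {t} → t ∈ l' → B t → t ≡ w')
  trimEnd B? {u} p m b with B? u
  ... | yes bu = u , _ , bu , one , (λ { (here refl) → first∈ p }) , λ m' _ → ∈-singleton m'
  trimEnd B? one (here refl) b | no ¬bu = ⊥-elim (¬bu b)
  trimEnd B? (e ◂ p) (here refl) b | no ¬bu = ⊥-elim (¬bu b)
  trimEnd B? {u} (e ◂ p) (there m) b | no ¬bu with trimEnd B? p m b
  ... | w' , l' , bw , q , sub , only = w' , u ∷ l' , bw , e ◂ q ,
        (λ { (here r) → here r ; (there m') → there (sub m') }) ,
        λ { (here refl) bt → ⊥-elim (¬bu bt) ; (there m') → only m' }

-- After trimming, a vertex of `A` or `B` chosen elsewhere can lie on the path only at the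
-- corresponding end, so excluding that end keeps it off the whole path.
trim : ∀ {V : Set} {E : V → V → Set} {A B : V → Set} → (∀ v → Dec (A v)) → (∀ v → Dec (B v)) →
       ∀ {l} → ABWalk E A B l →
       ∃ λ u → ∃ λ w → ∃ λ l' → A u × B w × Path E u l' w × (∀ {t} → t ∈ l' → t ∈ l) ×
       (∀ {t} → t ∈ l' → A t → t ≡ u) × (∀ {t} → t ∈ l' → B t → t ≡ w)
trim A? B? (_ , _ , a , b , p) with trimStart A? p (first∈ p) a
... | u , l₁ , au , q , sub₁ , only₁ with trimEnd B? q (last∈ q) b
...   | w , l₂ , bw , r , sub₂ , only₂ = u , w , l₂ , au , bw , r , sub₁ ∘ sub₂ , only₁ ∘ sub₂ , only₂

module _ {V : Set} where

  order₂ : ∀ (P : V → Set) {p q : V} {l} → p ≢ q → p ∈ l → q ∈ l → P p → P q →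
           ∃ λ p' → ∃ λ q' → ∃ λ A → ∃ λ B → ∃ λ C → l ≡ A ++ p' ∷ B ++ q' ∷ C × P p' × P q'
             × ((p' ≡ p × q' ≡ q) ⊎ (p' ≡ q × q' ≡ p))
  order₂ P {p} {q} ne p∈ q∈ Pp Pq with ∈-∃++ p∈
  ... | A , B , refl with ∈-++⁻ A q∈
  ...   | inj₁ q∈A with ∈-∃++ q∈A
  ...     | A₁ , A₂ , refl = q , p , A₁ , A₂ , B , ++-assoc A₁ (q ∷ A₂) (p ∷ B) , Pq , Pp , inj₂ (refl , refl)
  order₂ P ne p∈ q∈ Pp Pq | A , B , refl | inj₂ (here refl) = ⊥-elim (ne refl)
  order₂ P {p} {q} ne p∈ q∈ Pp Pq | A , B , refl | inj₂ (there q∈B) with ∈-∃++ q∈B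
  ...     | B₁ , B₂ , refl = p , q , A , B₁ , B₂ , refl , Pp , Pq , inj₁ (refl , refl)

  order₃ : ∀ (P : V → Set) {p q r : V} {l} → p ≢ q → p ≢ r → q ≢ r → p ∈ l → q ∈ l → r ∈ l → P p → P q → P r →
           ∃ λ p' → ∃ λ q' → ∃ λ r' → ∃ λ A → ∃ λ B → ∃ λ C → ∃ λ F →
             l ≡ A ++ p' ∷ B ++ q' ∷ C ++ r' ∷ F × P p' × P q' × P r'
  order₃ P {p} {q} {r} p≢q p≢r q≢r p∈ q∈ r∈ Pp Pq Pr with order₂ P p≢q p∈ q∈ Pp Pq
  ... | f , s , A , B , C , refl , Pf , Ps , eqs with ∈-++⁻ A r∈
  ...   | inj₁ r∈A with ∈-∃++ r∈A
  ...     | A₁ , A₂ , refl = r , f , s , A₁ , A₂ , B , C , ++-assoc A₁ (r ∷ A₂) (f ∷ B ++ s ∷ C) , Pr , Pf , Ps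
  order₃ P {p} {q} {r} p≢q p≢r q≢r p∈ q∈ r∈ Pp Pq Pr | f , s , A , B , C , refl , Pf , Ps , eqs | inj₂ (here r≡f) =
    ⊥-elim (neq eqs r≡f)
    where
    neq : (f ≡ p × s ≡ q) ⊎ (f ≡ q × s ≡ p) → r ≢ f
    neq (inj₁ (refl , _)) refl = p≢r refl
    neq (inj₂ (refl , _)) refl = q≢r refl
  order₃ P {p} {q} {r} p≢q p≢r q≢r p∈ q∈ r∈ Pp Pq Pr | f , s , A , B , C , refl , Pf , Ps , eqs | inj₂ (there r∈')
    with order₂ P (neq eqs) (∈-insert B) r∈' Ps Pr
    where
    neq : (f ≡ p × s ≡ q) ⊎ (f ≡ q × s ≡ p) → s ≢ r
    neq (inj₁ (_ , refl)) = q≢r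
    neq (inj₂ (_ , refl)) = p≢r
  ... | s' , t' , A' , B' , C' , e , Ps' , Pt' , _ = f , s' , t' , A , A' , B' , C' , cong (λ m → A ++ f ∷ m) e , Pf , Ps' , Pt'

module _ {n} (D : Digraph n) where

  no-loop : ∀ {v} → ¬ Arc D v v
  no-loop {v} e with trans (sym e) (loopless D v)
  ... | ()

  arc? : ∀ u w → Dec (Arc D u w)
  arc? u w = arc D u w Data.Bool.≟ true

-- Two vertices on no common cycle

Inner : ∀ {n} → Fin n → Fin n → Fin n → Set
Inner x y v = v ≢ x × v ≢ y

InnerArc : ∀ {n} → Digraph n → Fin n → Fin n → Fin n → Fin n → Set
InnerArc D x y u w = Arc D u w × Inner x y u × Inner x y w

-- A walk in D − {x , y} that can be prolonged to a walk from s to t.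
Via : ∀ {n} → Digraph n → (x y s t : Fin n) → List (Fin n) → Set
Via D x y s t = ABWalk (InnerArc D x y) (λ u → Arc D s u) (λ w → Arc D w t)

-- z has at least five two-arc connections with y, counting y → w → z and z → w → y separately.
WellConnected : ∀ {n} → Digraph n → (y z : Fin n) → Set
WellConnected D y z = ∀ fs gs → length fs + length gs ≤ 4 →
  (∀ w → Arc D y w → Arc D w z → w ∈ fs) → (∀ w → Arc D z w → Arc D w y → w ∈ gs) → ⊥

-- The data are closed under exchanging `x` with `y` and under reversing all arcs, so each lemma is
-- proved for one of its four forms only. `unlinked` expresses that no cycle passes through both
-- vertices.
record Setup {n} (D : Digraph n) (x y : Fin n) : Set where
  field
    x↛y : ¬ Arc D x y
    y↛x : ¬ Arc D y x
    walk-yx : ∀ p → ∃ λ l → Via D x y y x l × p ∉ l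
    walk-xy : ∀ p → ∃ λ l → Via D x y x y l × p ∉ l
    conn-x : ∀ {z} → Inner x y z → ¬ Arc D x z → ¬ Arc D z x → WellConnected D x z
    conn-y : ∀ {z} → Inner x y z → ¬ Arc D y z → ¬ Arc D z y → WellConnected D y z
    unlinked : ∀ {l₁ l₂} → Via D x y x y l₁ → Via D x y y x l₂ → Disj l₁ l₂ → ⊥

transpose : ∀ {n} → Digraph n → Digraph n
transpose D = record { arc = λ u w → arc D w u ; loopless = loopless D }

swapVia : ∀ {n} {D : Digraph n} {x y s t l} → Via D x y s t l → Via D y x s t l
swapVia (u , w , a , b , p) = u , w , a , b ,
  mapPath (λ { (e , (i , j) , (k , m)) → e , (j , i) , (m , k) }) p

transposeVia : ∀ {n} {D : Digraph n} {x y s t l} → Via D x y s t l →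
               ∃ λ l' → Via (transpose D) x y t s l' × (∀ {v} → v ∈ l' → v ∈ l)
transposeVia (u , w , a , b , p) with reversePath p
... | l' , q , sub = l' , (w , u , b , a , mapPath (λ { (e , i , j) → e , j , i }) q) , sub

transposeConn : ∀ {n} {D : Digraph n} {y z} → WellConnected D y z → WellConnected (transpose D) y z
transposeConn c fs gs le f g = c gs fs (subst (_≤ 4) (+-comm (length fs) (length gs)) le)
  (λ w a b → g w b a) (λ w a b → f w b a)

module _ {n} {D : Digraph n} {x y : Fin n} (S : Setup D x y) where
  open Setup S

  swapSetup : Setup D y x
  swapSetup = record
    { x↛y = y↛x ; y↛x = x↛y
    ; walk-yx = λ p → let l , v , q = walk-xy p in l , swapVia {D = D} v , q
    ; walk-xy = λ p → let l , v , q = walk-yx p in l , swapVia {D = D} v , q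
    ; conn-x = λ { (i , j) → conn-y (j , i) } ; conn-y = λ { (i , j) → conn-x (j , i) }
    ; unlinked = λ v₁ v₂ d → unlinked (swapVia {D = D} v₂) (swapVia {D = D} v₁) (λ m m' → d m' m) }

  transposeSetup : Setup (transpose D) x y
  transposeSetup = record
    { x↛y = y↛x ; y↛x = x↛y
    ; walk-yx = λ p → let l , v , q = walk-xy p ; l' , v' , sub = transposeVia {D = D} v in l' , v' , q ∘ sub
    ; walk-xy = λ p → let l , v , q = walk-yx p ; l' , v' , sub = transposeVia {D = D} v in l' , v' , q ∘ sub
    ; conn-x = λ i a b → transposeConn {D = D} (conn-x i b a) ; conn-y = λ i a b → transposeConn {D = D} (conn-y i b a)
    ; unlinked = λ v₁ v₂ d →
        let l₁ , w₁ , s₁ = transposeVia {D = transpose D} v₁ ; l₂ , w₂ , s₂ = transposeVia {D = transpose D} v₂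
        in unlinked w₂ w₁ (λ m m' → d (s₁ m') (s₂ m)) }

  private
    Y→X : List (Fin n) → Set
    Y→X = Via D x y y x

    out-x : ∀ {v} → Arc D x v → Inner x y v
    out-x e = (λ { refl → no-loop D e }) , λ { refl → x↛y e }
    out-y : ∀ {v} → Arc D y v → Inner x y v
    out-y e = (λ { refl → y↛x e }) , λ { refl → no-loop D e }
    in-x : ∀ {v} → Arc D v x → Inner x y v
    in-x e = (λ { refl → no-loop D e }) , λ { refl → y↛x e }
    in-y : ∀ {v} → Arc D v y → Inner x y v
    in-y e = (λ { refl → x↛y e }) , λ { refl → no-loop D e }

    -- `x → a → v → y` and a walk from `y` to `x` missing `a` and `v` would close to a cycle through
    -- both. Hence {a, v} meets every walk from `y` to `x`.
    cut : ∀ {a v l} → Arc D x a → Arc D a v → Arc D v y → Y→X l → a ∉ l → v ∉ l → ⊥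
    cut xa av vy w na nv = unlinked (_ , _ , xa , vy , (av , out-x xa , in-y vy) ◂ one) w
      λ { (here refl) → na ; (there (here refl)) → nv }

  no-x·y : ∀ {q} → Arc D x q → Arc D q y → ⊥
  no-x·y {q} xq qy with walk-yx q
  ... | l , w , q∉ = unlinked (_ , _ , xq , qy , one) w λ { (here refl) → q∉ }

  private
    -- On disjoint y–x walks R₁, R₂ every cut {a , v} has one vertex on each.
    ladder-core : ∀ {z v v' R₁ l₁ l₂} → Arc D x z → Arc D z v → Arc D z v' → Arc D v y → Arc D v' y →
      Y→X R₁ → Unique R₁ → Y→X (l₁ ++ v ∷ l₂) → Unique (l₁ ++ v ∷ l₂) → Disj R₁ (l₁ ++ v ∷ l₂) →
      z ∉ l₁ ++ v ∷ l₂ → v' ∉ l₁ → v' ≢ v → ⊥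
    ladder-core {z} {v} {v'} {R₁} {l₁} {l₂} xz zv zv' vy v'y (a₁ , b₁ , ya₁ , b₁x , p₁) un₁ (a₂ , b₂ , ya₂ , b₂x , p₂) un₂ dj z∉ v'∉ v'≢v =
        -- Of the at least five connections between `x` and `v`, only those through `z` and `v'` can
        -- have the form `v → w → x`. This leaves three distinct vertices `u` with `x → u → v`.
        conn [] (s≤s (s≤s z≤n)) λ u₁ x1 1v → ⊥-elim
          (conn (u₁ ∷ []) (s≤s (s≤s (s≤s z≤n))) λ u₂ x2 2v → listed u₂ _ λ u₂∉ →
            conn (u₂ ∷ u₁ ∷ []) (s≤s (s≤s (s≤s (s≤s z≤n)))) λ u₃ x3 3v → listed u₃ _ λ u₃∉ →
              finish x1 1v x2 2v x3 3v (λ { refl → u₂∉ (here refl) }) (λ { refl → u₃∉ (there (here refl)) }) (λ { refl → u₃∉ (here refl) }))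
      where
      listed : ∀ u l → (u ∉ l → ⊥) → u ∈ l
      listed u l k with u ∈? l
      ... | yes m = m
      ... | no m = ⊥-elim (k m)
      prefix : Path (InnerArc D x y) a₂ (l₁ ++ v ∷ []) v
      prefix = proj₁ (splitPath l₁ p₂)
      suffix : Path (InnerArc D x y) v (v ∷ l₂) b₂
      suffix = proj₂ (splitPath l₁ p₂)
      z∉prefix : z ∉ l₁ ++ v ∷ []
      z∉prefix = ∉-++ l₁ (z∉ ∘ ∈-++⁺ˡ) λ { (here refl) → z∉ (∈-insert l₁) }
      v'∉prefix : v' ∉ l₁ ++ v ∷ []
      v'∉prefix = ∉-++ l₁ v'∉ λ { (here e) → v'≢v e }
      -- As `v` precedes `v'`, the prefix up to `v` avoids the cut {z, v'}; it must not be completed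
      -- to `x`.
      v↛x : ¬ Arc D v x
      v↛x vx = cut xz zv' v'y (_ , _ , ya₂ , vx , prefix) z∉prefix v'∉prefix
      conn : ∀ fs → length fs + 2 ≤ 4 → (∀ w → Arc D x w → Arc D w v → w ∈ fs) → ⊥
      conn fs le f = conn-x (in-y vy) (λ xv → no-x·y xv vy) v↛x fs (z ∷ v' ∷ []) le f
        λ w vw wx → listed w _ λ w∉ →
          cut xz zv' v'y (_ , _ , ya₂ , wx , join prefix (vw , in-y vy , in-x wx) one)
            (∉-++ (l₁ ++ v ∷ []) z∉prefix λ { (here refl) → w∉ (here refl) })
            (∉-++ (l₁ ++ v ∷ []) v'∉prefix λ { (here refl) → w∉ (there (here refl)) })
      v∉R₁ : v ∉ R₁
      v∉R₁ m = dj m (∈-insert l₁)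
      onR₁ : ∀ {u} → Arc D x u → Arc D u v → u ∈ R₁
      onR₁ {u} xu uv with u ∈? R₁
      ... | yes m = m
      ... | no m = ⊥-elim (cut xu uv vy (a₁ , b₁ , ya₁ , b₁x , p₁) m v∉R₁)
      finish : ∀ {u₁ u₂ u₃} → Arc D x u₁ → Arc D u₁ v → Arc D x u₂ → Arc D u₂ v → Arc D x u₃ → Arc D u₃ v →
               u₁ ≢ u₂ → u₁ ≢ u₃ → u₂ ≢ u₃ → ⊥
      finish x1 1v x2 2v x3 3v n₁₂ n₁₃ n₂₃
        with order₃ (λ u → Arc D x u × Arc D u v) n₁₂ n₁₃ n₂₃ (onR₁ x1 1v) (onR₁ x2 2v) (onR₁ x3 3v) (x1 , 1v) (x2 , 2v) (x3 , 3v)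
      ... | p , q , r , A , B , C , F , refl , (xp , pv) , (xq , qv) , (xr , rv) =
          -- The middle vertex `q` is non-adjacent to `y` yet has at most three connections with it:
          -- `y → w → q` forces `w` to be `p` or `v`, as the rest of `R₁` from `q` avoids the cut
          -- {p, v}, and `q → w → y` forces `w = v`.
          conn-y (out-x xq) y↛q (no-x·y xq) (p ∷ v ∷ []) (v ∷ []) (s≤s (s≤s (s≤s z≤n)))
            (λ w yw wq → listed w _ λ w∉ → cut xp pv vy
               (_ , _ , yw , b₁x , (wq , out-y yw , out-x xq) ◂ from-q)
               (∉-∷ (λ { refl → w∉ (here refl) }) p∉from-q) (∉-∷ (λ { refl → w∉ (there (here refl)) }) v∉from-q))
            λ w qw wy → listed w _ λ w∉ → late qw wy (w∉ ∘ here)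
        where
        eq : A ++ p ∷ B ++ q ∷ C ++ r ∷ F ≡ (A ++ p ∷ B) ++ q ∷ C ++ r ∷ F
        eq = sym (++-assoc A (p ∷ B) (q ∷ C ++ r ∷ F))
        p₁' : Path (InnerArc D x y) a₁ ((A ++ p ∷ B) ++ q ∷ C ++ r ∷ F) b₁
        p₁' = subst (λ l → Path (InnerArc D x y) a₁ l b₁) eq p₁
        un₁' : Unique ((A ++ p ∷ B) ++ q ∷ C ++ r ∷ F)
        un₁' = subst Unique eq un₁
        to-q : Path (InnerArc D x y) a₁ ((A ++ p ∷ B) ++ q ∷ []) q
        to-q = proj₁ (splitPath (A ++ p ∷ B) p₁')
        from-q : Path (InnerArc D x y) q (q ∷ C ++ r ∷ F) b₁
        from-q = proj₂ (splitPath (A ++ p ∷ B) p₁')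
        to-p : Path (InnerArc D x y) a₁ (A ++ p ∷ []) p
        to-p = proj₁ (splitPath A p₁)
        sep : ∀ {t} → t ∈ A ++ p ∷ B → t ∉ q ∷ C ++ r ∷ F
        sep = proj₂ (proj₂ (Unique-++⁻ (A ++ p ∷ B) un₁'))
        inR₁ : ∀ {t} → t ∈ (A ++ p ∷ B) ++ q ∷ C ++ r ∷ F → t ∈ A ++ p ∷ B ++ q ∷ C ++ r ∷ F
        inR₁ {t} = subst (t ∈_) (sym eq)
        p∉from-q : p ∉ q ∷ C ++ r ∷ F
        p∉from-q = sep (∈-insert A)
        v∉from-q : v ∉ q ∷ C ++ r ∷ F
        v∉from-q m = v∉R₁ (inR₁ (∈-++⁺ʳ (A ++ p ∷ B) m))
        y↛q : ¬ Arc D y q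
        y↛q yq = cut xp pv vy (_ , _ , yq , b₁x , from-q) p∉from-q v∉from-q
        q∈R₁ : q ∈ A ++ p ∷ B ++ q ∷ C ++ r ∷ F
        q∈R₁ = inR₁ (∈-insert (A ++ p ∷ B))
        r∈from : r ∈ q ∷ C ++ r ∷ F
        r∈from = there (∈-insert C)
        r∈R₁ : r ∈ A ++ p ∷ B ++ q ∷ C ++ r ∷ F
        r∈R₁ = inR₁ (∈-++⁺ʳ (A ++ p ∷ B) r∈from)
        r∉to-q : r ∉ (A ++ p ∷ B) ++ q ∷ []
        r∉to-q = ∉-++ (A ++ p ∷ B) (λ m → sep m r∈from)
                   λ { (here refl) → proj₂ (Unique-split (A ++ p ∷ B) un₁') (∈-insert C) }
        to-q⊆ : ∀ {t} → t ∈ (A ++ p ∷ B) ++ q ∷ [] → t ∈ A ++ p ∷ B ++ q ∷ C ++ r ∷ F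
        to-q⊆ m with ∈-++⁻ (A ++ p ∷ B) m
        ... | inj₁ a = inR₁ (∈-++⁺ˡ a)
        ... | inj₂ (here refl) = q∈R₁
        to-p⊆ : ∀ {t} → t ∈ A ++ p ∷ [] → t ∈ A ++ p ∷ B
        to-p⊆ m with ∈-++⁻ A m
        ... | inj₁ a = ∈-++⁺ˡ a
        ... | inj₂ (here refl) = ∈-insert A
        -- In each case some walk from `y` to `x` misses a cut. If `w` is off `R₂`, then `R₂` misses
        -- {q, w}. If `w` precedes `v`, going along `R₁` to `p`, over to `v` and on along `R₂`
        -- misses {q, w}. If `w` follows `v`, going along `R₁` to `q`, over to `w` and on along `R₂`
        -- misses {r, v}; this is the use of the third vertex `r`.
        late : ∀ {w} → Arc D q w → Arc D w y → w ≢ v → ⊥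
        late {w} qw wy w≢v with w ∈? (l₁ ++ v ∷ l₂)
        ... | no w∉ = cut xq qw wy (a₂ , b₂ , ya₂ , b₂x , p₂) (dj q∈R₁) w∉
        ... | yes w∈ with ∈-++⁻ l₁ w∈
        ...   | inj₁ w∈l₁ = cut xq qw wy (_ , _ , ya₁ , b₂x , join to-p (pv , out-x xp , in-y vy) suffix)
                  (∉-++ (A ++ p ∷ []) (λ m → sep (to-p⊆ m) (here refl)) (λ m → dj q∈R₁ (∈-++⁺ʳ l₁ m)))
                  (∉-++ (A ++ p ∷ []) (λ m → dj (inR₁ (∈-++⁺ˡ (to-p⊆ m))) w∈) (λ m → proj₂ (proj₂ (Unique-++⁻ l₁ un₂)) w∈l₁ m))
        ...   | inj₂ (here e) = w≢v e
        ...   | inj₂ (there w∈l₂) with ∈-∃++ w∈l₂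
        ...     | m₁ , m₂ , refl = cut xr rv vy
                    (_ , _ , ya₁ , b₂x , join to-q (qw , out-x xq , in-y wy) (proj₂ (splitPath (v ∷ m₁) suffix)))
                    (∉-++ ((A ++ p ∷ B) ++ q ∷ []) r∉to-q (λ m → dj r∈R₁ (∈-++⁺ʳ l₁ (there (∈-++⁺ʳ m₁ m)))))
                    (∉-++ ((A ++ p ∷ B) ++ q ∷ []) (v∉R₁ ∘ to-q⊆) (λ m → proj₂ (Unique-split l₁ un₂) (∈-++⁺ʳ m₁ m)))

    -- Since `z` is off `R₂`, the cuts {z, v} and {z, v'} force both `v` and `v'` onto `R₂`; by
    -- symmetry the earlier of them plays the part of `v`.
    ladder-disjoint : ∀ {z v v' R₁ R₂} → Arc D x z → Arc D z v → Arc D z v' → Arc D v y → Arc D v' y → v ≢ v' →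
      Y→X R₁ → Unique R₁ → Y→X R₂ → Unique R₂ → Disj R₁ R₂ → z ∉ R₂ → ⊥
    ladder-disjoint {z} {v} {v'} {R₁} {R₂} xz zv zv' vy v'y v≢v' w₁ un₁ w₂ un₂ dj z∉ with v ∈? R₂ | v' ∈? R₂
    ... | no v∉ | _ = cut xz zv vy w₂ z∉ v∉
    ... | yes _ | no v'∉ = cut xz zv' v'y w₂ z∉ v'∉
    ... | yes v∈ | yes v'∈ with ∈-∃++ v∈
    ...   | l₁ , l₂ , refl with v' ∈? l₁
    ...     | no v'∉l₁ = ladder-core xz zv zv' vy v'y w₁ un₁ w₂ un₂ dj z∉ v'∉l₁ (v≢v' ∘ sym)
    ...     | yes v'∈l₁ with ∈-∃++ v'∈l₁
    ...       | m₁ , m₂ , refl = ladder-core {l₁ = m₁} xz zv' zv v'y vy w₁ un₁ (subst Y→X e w₂) (subst Unique e un₂)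
                  (λ m m' → dj m (subst (_ ∈_) (sym e) m')) (λ m → z∉ (subst (_ ∈_) (sym e) m))
                  (λ m → proj₁ (Unique-split (m₁ ++ v' ∷ m₂) un₂) (∈-++⁺ˡ m)) v≢v'
      where e = ++-assoc m₁ (v' ∷ m₂) (v ∷ l₂)

  -- Of two disjoint walks from `y` to `x` at most one contains `z`; the other serves as `R₂`. The
  -- vertex passed to `twoPaths` only selects the walk from which its construction starts.
  ladder : ∀ {z v v'} → Arc D x z → Arc D z v → Arc D z v' → Arc D v y → Arc D v' y → v ≢ v' → ⊥
  ladder {z} xz zv zv' vy v'y v≢v' with Menger.twoPaths (InnerArc D x y) _ _ walk-yx z
  ... | R₁ , R₂ , (a₁ , b₁ , ya₁ , b₁x , p₁) , (a₂ , b₂ , ya₂ , b₂x , p₂) , dj with simple p₁ | simple p₂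
  ...   | Q₁ , q₁ , un₁ , s₁ | Q₂ , q₂ , un₂ , s₂ with z ∈? Q₂
  ...     | no z∉ = ladder-disjoint xz zv zv' vy v'y v≢v' (a₁ , b₁ , ya₁ , b₁x , q₁) un₁ (a₂ , b₂ , ya₂ , b₂x , q₂) un₂
                      (λ m m' → dj (s₁ m) (s₂ m')) z∉
  ...     | yes z∈ = ladder-disjoint xz zv zv' vy v'y v≢v' (a₂ , b₂ , ya₂ , b₂x , q₂) un₂ (a₁ , b₁ , ya₁ , b₁x , q₁) un₁
                      (λ m m' → dj (s₁ m') (s₂ m)) (λ m → dj (s₁ m) (s₂ z∈))

data Short {V : Set} : List V → Set where
  none : Short []
  single : ∀ {v} → Short (v ∷ [])

Short-length : ∀ {V : Set} {l : List V} → Short l → length l ≤ 1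
Short-length none = z≤n
Short-length single = s≤s z≤n

module _ {n} {D : Digraph n} {x y : Fin n} (S : Setup D x y) where
  open Setup S

  -- If `y → q` but not `x → q`, then `q` and `x` are non-adjacent and have at least five
  -- connections, of which `ladder` allows only one of the form `q → g → x`. The other four have the
  -- form `x → u → q`, one more than `ex` can block.
  detour : ∀ {q} → Arc D x q ⊎ Arc D y q → ∀ ex → length ex ≤ 3 →
           (Arc D x q → ⊥) → (∀ u → Arc D x u → Arc D u q → u ∉ ex → ⊥) → ⊥
  detour {q} (inj₁ xq) ex le direct via = direct xq
  detour {q} (inj₂ yq) ex le direct via = conn [] (≤-trans (≤-reflexive (+-identityʳ _)) (≤-trans le (s≤s (s≤s (s≤s z≤n)))))
      λ g qg gx → ⊥-elim (conn (g ∷ []) (≤-trans (≤-reflexive (+-comm _ 1)) (s≤s le)) λ g' qg' g'x → same qg gx qg' g'x)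
    where
    same : ∀ {g g'} → Arc D q g → Arc D g x → Arc D q g' → Arc D g' x → g' ∈ g ∷ []
    same {g} {g'} qg gx qg' g'x with g' ≟ g
    ... | yes e = here e
    ... | no ne = ⊥-elim (ladder (swapSetup S) yq qg' qg g'x gx ne)
    listed : ∀ u → Arc D x u → Arc D u q → u ∈ ex
    listed u xu uq with u ∈? ex
    ... | yes m = m
    ... | no m = ⊥-elim (via u xu uq m)
    conn : ∀ gs → length ex + length gs ≤ 4 → (∀ w → Arc D q w → Arc D w x → w ∈ gs) → ⊥
    conn gs le' g = conn-x ((λ { refl → y↛x yq }) , λ { refl → no-loop D yq }) direct (no-x·y (swapSetup S) yq) ex gs le' listed g

  inner-out : ∀ {q} → Arc D x q ⊎ Arc D y q → Inner x y q
  inner-out (inj₁ xq) = (λ { refl → no-loop D xq }) , λ { refl → x↛y xq }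
  inner-out (inj₂ yq) = (λ { refl → y↛x yq }) , λ { refl → no-loop D yq }

  -- The form with a continuation into `⊥` is due to `detour`, which yields its vertex only under
  -- double negation.
  prolongFront : ∀ {u l w} → Path (InnerArc D x y) u l w → Arc D x u ⊎ Arc D y u → ∀ ex → length ex ≤ 3 →
    (∀ hs l' u' → Short hs → (∀ {v} → v ∈ hs → Arc D x v × v ∉ ex) → Arc D x u' →
       Path (InnerArc D x y) u' l' w → (∀ {v} → v ∈ l' → v ∈ hs ⊎ v ∈ l) → ⊥) → ⊥
  prolongFront p a ex le k = detour a ex le
    (λ xu → k [] _ _ none (λ ()) xu p inj₂)
    λ h xh hu h∉ → k (h ∷ []) _ h single (λ { (here refl) → xh , h∉ }) xh ((hu , inner-out (inj₁ xh) , inner-out a) ◂ p)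
      λ { (here e) → inj₁ (here e) ; (there m) → inj₂ m }

module _ {n} {D : Digraph n} {x y : Fin n} (S : Setup D x y) where

  prolongBack : ∀ {u l w} → Path (InnerArc D x y) u l w → Arc D w x ⊎ Arc D w y → ∀ ex → length ex ≤ 3 →
    (∀ hs l' w' → Short hs → (∀ {v} → v ∈ hs → Arc D v x × v ∉ ex) → Arc D w' x →
       Path (InnerArc D x y) u l' w' → (∀ {v} → v ∈ l' → v ∈ hs ⊎ v ∈ l) → ⊥) → ⊥
  prolongBack {l = l} p b ex le k = detour (transposeSetup S) b ex le
    (λ wx → k [] _ _ none (λ ()) wx p inj₂)
    λ h hx wh h∉ → k (h ∷ []) _ h single (λ { (here refl) → hx , h∉ }) hx
      (join p (wh , inner-out (transposeSetup S) b , inner-out (transposeSetup S) (inj₁ hx)) one)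
      λ m → ⊎-swap (∈-++⁻ l m)

module _ {n} {D : Digraph n} {x y : Fin n} (S : Setup D x y) where
  open Setup S

  private
    A B : Fin n → Set
    A u = Arc D x u ⊎ Arc D y u
    B w = Arc D w x ⊎ Arc D w y

    swapPath : ∀ {u l w} → Path (InnerArc D x y) u l w → Path (InnerArc D y x) u l w
    swapPath = mapPath (λ { (e , (i , j) , (k , m)) → e , (j , i) , (m , k) })
    swapPath' : ∀ {u l w} → Path (InnerArc D y x) u l w → Path (InnerArc D x y) u l w
    swapPath' = mapPath (λ { (e , (i , j) , (k , m)) → e , (j , i) , (m , k) })

    walk : ∀ p → ∃ λ l → ABWalk (InnerArc D x y) A B l × p ∉ l
    walk p with walk-yx p
    ... | l , (u , w , a , b , q) , p∉ = l , (u , w , inj₂ a , inj₁ b , q) , p∉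

  linked : ⊥
  linked with Menger.twoPaths (InnerArc D x y) A B walk x
  ... | l₁ , l₂ , w₁ , w₂ , dj
    with trim (λ v → arc? D x v ⊎-dec arc? D y v) (λ v → arc? D v x ⊎-dec arc? D v y) w₁
       | trim (λ v → arc? D x v ⊎-dec arc? D y v) (λ v → arc? D v x ⊎-dec arc? D v y) w₂
  ... | a₁ , b₁ , Q₁ , Aa₁ , Bb₁ , p₁ , sub₁ , onlyA₁ , onlyB₁ | a₂ , b₂ , Q₂ , Aa₂ , Bb₂ , p₂ , sub₂ , onlyA₂ , onlyB₂ =
    -- Each of the four ends may need one new vertex. Its exclusion list holds the end of the other
    -- path in the same class, which suffices by trimming, and the vertices already added to the
    -- other path. The longest list, the last one, has three entries: the bound in `detour`.
    prolongFront S p₁ Aa₁ (a₂ ∷ []) (s≤s z≤n) λ hx T₁ c₁ sx hx-ok xc₁ t₁ in₁ →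
    prolongFront (swapSetup S) (swapPath p₂) (⊎-swap Aa₂) (a₁ ∷ hx) (≤-trans (s≤s (Short-length sx)) (s≤s (s≤s z≤n))) λ hy T₂ c₂ sy hy-ok yc₂ t₂ in₂ →
    prolongBack (swapSetup S) (swapPath t₁) (⊎-swap Bb₁) (b₂ ∷ hy) (≤-trans (s≤s (Short-length sy)) (s≤s (s≤s z≤n))) λ ky U₁ d₁ sky ky-ok d₁y u₁ in₁' →
    prolongBack S (swapPath' t₂) Bb₂ (b₁ ∷ hx ++ ky) (s≤s (≤-trans (≤-reflexive (length-++ hx)) (+-mono-≤ (Short-length sx) (Short-length sky)))) λ kx U₂ d₂ skx kx-ok d₂x u₂ in₂' →
    let
      dj' : ∀ {v} → v ∈ ky ⊎ (v ∈ hx ⊎ v ∈ Q₁) → v ∈ kx ⊎ (v ∈ hy ⊎ v ∈ Q₂) → ⊥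
      dj' = λ where
        (inj₁ a) (inj₁ b) → proj₂ (kx-ok b) (there (∈-++⁺ʳ hx a))
        (inj₁ a) (inj₂ (inj₁ b)) → proj₂ (ky-ok a) (there b)
        (inj₁ a) (inj₂ (inj₂ b)) → proj₂ (ky-ok a) (here (onlyB₂ b (inj₂ (proj₁ (ky-ok a)))))
        (inj₂ (inj₁ a)) (inj₁ b) → proj₂ (kx-ok b) (there (∈-++⁺ˡ a))
        (inj₂ (inj₁ a)) (inj₂ (inj₁ b)) → proj₂ (hy-ok b) (there a)
        (inj₂ (inj₁ a)) (inj₂ (inj₂ b)) → proj₂ (hx-ok a) (here (onlyA₂ b (inj₁ (proj₁ (hx-ok a)))))
        (inj₂ (inj₂ a)) (inj₁ b) → proj₂ (kx-ok b) (here (onlyB₁ a (inj₁ (proj₁ (kx-ok b)))))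
        (inj₂ (inj₂ a)) (inj₂ (inj₁ b)) → proj₂ (hy-ok b) (here (onlyA₁ a (inj₂ (proj₁ (hy-ok b)))))
        (inj₂ (inj₂ a)) (inj₂ (inj₂ b)) → dj (sub₁ a) (sub₂ b)
    in unlinked (c₁ , d₁ , xc₁ , d₁y , swapPath' u₁) (c₂ , d₂ , yc₂ , d₂x , u₂)
         λ m m' → dj' (⊎-map₂ in₁ (in₁' m)) (⊎-map₂ in₂ (in₂' m'))

-- Degrees and insertion

module _ {V : Set} where

  complement : ∀ {l vs : List V} → Unique l → (∀ {v} → v ∈ l → v ∈ vs) → ∃ λ ω → l ++ ω ↭ vs
  complement {[]} {vs} un sub = vs , ↭-refl
  complement {x ∷ l} un sub with ∈-∃++ (sub (here refl))
  ... | A , B , refl with complement {l} {A ++ B} (Unique-tail un) sub'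
    where
    sub' : ∀ {v} → v ∈ l → v ∈ A ++ B
    sub' m with ∈-++⁻ A (sub (there m))
    ... | inj₁ a = ∈-++⁺ˡ a
    ... | inj₂ (here refl) = ⊥-elim (Unique[x∷xs]⇒x∉xs un m)
    ... | inj₂ (there b) = ∈-++⁺ʳ A b
  ...   | ω , p = ω , ↭-trans (prep x p) (↭-sym (shift x A B))

  Unique-⊆-length : ∀ {l vs : List V} → Unique l → (∀ {v} → v ∈ l → v ∈ vs) → length l ≤ length vs
  Unique-⊆-length {l} un sub with complement un sub
  ... | ω , p = ≤-trans (m≤m+n (length l) (length ω)) (≤-reflexive (trans (sym (length-++ l)) (↭-length p)))

  pull : ∀ {v : V} {l} → v ∈ l → ∃ λ l' → l ↭ v ∷ l'
  pull m with ∈-∃++ m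
  ... | A , B , refl = A ++ B , shift _ A B

  -- The exempt vertex occurs at most once in a duplicate-free list, so its surplus `d` is paid
  -- once.
  Σ-atmost : ∀ (M : V → Set) (M? : ∀ v → Dec (M v)) (f : V → ℕ) k d l → Unique l →
             (∀ {q q'} → ¬ M q → ¬ M q' → q ≡ q') →
             (∀ {q} → q ∈ l → M q → f q ≤ k) → (∀ {q} → q ∈ l → f q ≤ k + d) → Σ[ f ] l ≤ length l * k + d
  Σ-atmost M M? f k d [] un ex h h' = z≤n
  Σ-atmost M M? f k d (x ∷ l) un ex h h' with M? x
  ... | yes mx = ≤-trans (+-mono-≤ (h (here refl) mx) (Σ-atmost M M? f k d l (Unique-tail un) ex (h ∘ there) (h' ∘ there)))
                   (≤-reflexive (sym (+-assoc k (length l * k) d)))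
  ... | no ¬mx = ≤-trans (+-mono-≤ (h' (here refl)) (Σ-bound f k l h''))
                   (≤-reflexive (solve 3 (λ k d m → k :+ d :+ m := k :+ m :+ d) refl k d (length l * k)))
    where
    open +-*-Solver
    h'' : ∀ {v} → v ∈ l → f v ≤ k
    h'' {v} m with M? v
    ... | yes mv = h (there m) mv
    ... | no ¬mv = ⊥-elim (Unique[x∷xs]⇒x∉xs un (subst (_∈ l) (ex ¬mv ¬mx) m))

module _ {n} (D : Digraph n) where

  ε : Fin n → Fin n → ℕ
  ε u w = if arc D u w then 1 else 0

  adj : Fin n → Fin n → ℕ
  adj u w = ε u w + ε w u

  ε≤1 : ∀ u w → ε u w ≤ 1
  ε≤1 u w with arc D u w
  ... | true = ≤-refl
  ... | false = z≤n

  ε≡0 : ∀ {u w} → ¬ Arc D u w → ε u w ≡ 0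
  ε≡0 {u} {w} na with arc D u w
  ... | true = ⊥-elim (na refl)
  ... | false = refl

  ε+ε≤1 : ∀ {a b c d} → (Arc D a b → Arc D c d → ⊥) → ε a b + ε c d ≤ 1
  ε+ε≤1 {a} {b} {c} {d} h with arc? D a b | arc? D c d
  ... | yes p | yes q = ⊥-elim (h p q)
  ... | no p | _ rewrite ε≡0 p = ε≤1 c d
  ... | yes _ | no q rewrite ε≡0 q | +-identityʳ (ε a b) = ε≤1 a b

  adj≤2 : ∀ u w → adj u w ≤ 2
  adj≤2 u w = +-mono-≤ (ε≤1 u w) (ε≤1 w u)

  adj-self : ∀ v → adj v v ≡ 0
  adj-self v rewrite ε≡0 (no-loop D {v}) = refl

  adj≡0 : ∀ {u w} → ¬ Arc D u w → ¬ Arc D w u → adj u w ≡ 0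
  adj≡0 p q rewrite ε≡0 p | ε≡0 q = refl

  adj₂≤2 : ∀ {v s q} → (Arc D v q → Arc D q s → ⊥) → (Arc D s q → Arc D q v → ⊥) → adj v q + adj s q ≤ 2
  adj₂≤2 {v} {s} {q} h₁ h₂ = ≤-trans
    (≤-reflexive (solve 4 (λ a b c d → (a :+ b) :+ (c :+ d) := (a :+ d) :+ (c :+ b)) refl (ε v q) (ε q v) (ε s q) (ε q s)))
    (+-mono-≤ (ε+ε≤1 h₁) (ε+ε≤1 h₂))
    where open +-*-Solver

  adj₂≤3 : ∀ {v s q} → (Arc D v q → Arc D q s → ⊥) ⊎ (Arc D s q → Arc D q v → ⊥) → adj v q + adj s q ≤ 3
  adj₂≤3 {v} {s} {q} h = ≤-trans
    (≤-reflexive (solve 4 (λ a b c d → (a :+ b) :+ (c :+ d) := (a :+ d) :+ (c :+ b)) refl (ε v q) (ε q v) (ε s q) (ε q s)))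
    (bound h)
    where
    open +-*-Solver
    bound : (Arc D v q → Arc D q s → ⊥) ⊎ (Arc D s q → Arc D q v → ⊥) → (ε v q + ε q s) + (ε s q + ε q v) ≤ 3
    bound (inj₁ h₁) = +-mono-≤ (ε+ε≤1 h₁) (+-mono-≤ (ε≤1 s q) (ε≤1 q v))
    bound (inj₂ h₂) = +-mono-≤ (+-mono-≤ (ε≤1 v q) (ε≤1 q s)) (ε+ε≤1 h₂)

  Σ-adj-self : ∀ {s l} → s ∈ l → Σ[ adj s ] l + 2 ≤ length l * 2
  Σ-adj-self {s} {l} m with pull m
  ... | l' , p rewrite Σ-↭ (adj s) p | ↭-length p | adj-self s | +-comm (Σ[ adj s ] l') 2 =
    s≤s (s≤s (Σ-bound (adj s) 2 l' (λ _ → adj≤2 s _)))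

  Insertable : Fin n → List (Fin n) → Set
  Insertable s ρ = ∃ λ r₁ → ∃ λ p → ∃ λ q → ∃ λ r₂ → ρ ≡ r₁ ++ p ∷ q ∷ r₂ × Arc D p s × Arc D s q

  insert : ∀ {s ρ c a} → Path (Arc D) c ρ a → Insertable s ρ → ∃ λ ρ' → Path (Arc D) c ρ' a × ρ' ↭ s ∷ ρ
  insert {s} p (r₁ , b , q , r₂ , refl , bs , sq) with consecutive r₁ p
  ... | p₁ , _ , p₂ = (r₁ ++ b ∷ []) ++ s ∷ q ∷ r₂ , join p₁ bs (sq ◂ p₂) ,
        ↭-trans (shift s (r₁ ++ b ∷ []) (q ∷ r₂)) (prep s (subst (_↭ r₁ ++ b ∷ q ∷ r₂) (sym (++-assoc r₁ (b ∷ []) (q ∷ r₂))) ↭-refl))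

  -- Each of the |ρ| − 1 consecutive pairs p , q of ρ carries at most one of the arcs p → s and s → q.
  nonInsertable : ∀ {s ρ c a} → Path (Arc D) c ρ a → ¬ Insertable s ρ →
                  Σ[ adj s ] ρ + 1 ≤ length ρ + (ε s c + ε a s)
  nonInsertable {s} {c = c} one ni = ≤-reflexive
    (solve 2 (λ a b → a :+ b :+ con 0 :+ con 1 := con 1 :+ (a :+ b)) refl (ε s c) (ε c s))
    where open +-*-Solver
  nonInsertable {s} {c = c} {a} (_◂_ {u = u} {v = v} {l = l} e p) ni with nonInsertable {s} p
    (λ { (r₁ , b , q , r₂ , refl , bs , sq) → ni (u ∷ r₁ , b , q , r₂ , refl , bs , sq) })
  ... | ih = begin
      ε s u + ε u s + Σ[ adj s ] l + 1              ≡⟨ solve 3 (λ a b c → a :+ b :+ c :+ con 1 := a :+ b :+ (c :+ con 1)) refl (ε s u) (ε u s) (Σ[ adj s ] l) ⟩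
      ε s u + ε u s + (Σ[ adj s ] l + 1)            ≤⟨ +-monoʳ-≤ (ε s u + ε u s) ih ⟩
      ε s u + ε u s + (length l + (ε s v + ε a s))  ≡⟨ solve 5 (λ a b l d e → a :+ b :+ (l :+ (d :+ e)) := b :+ d :+ (l :+ (a :+ e))) refl (ε s u) (ε u s) (length l) (ε s v) (ε a s) ⟩
      ε u s + ε s v + (length l + (ε s u + ε a s))  ≤⟨ +-monoˡ-≤ _ (ε+ε≤1 (λ us sv → ni (top p us sv))) ⟩
      1 + (length l + (ε s u + ε a s))              ∎
    where
    open +-*-Solver
    open ≤-Reasoning
    top : ∀ {l v w} → Path (Arc D) v l w → Arc D u s → Arc D s v → Insertable s (u ∷ l)
    top one us sv = [] , _ , _ , _ , refl , us , sv
    top (_ ◂ _) us sv = [] , _ , _ , _ , refl , us , sv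

-- Enlarging cycles

private
  -- `P`, `g`, `p`, `r`, `o` are the sizes of `ρ`, `γ`, `ρ'`, `R`, `ω`; `sv`, `ov` count the arcs of
  -- `v` with `S₀` and `ω`, and `a`, `b`, `os` those of `s` with `ρ'`, `R`, `ω`. The bounds add up
  -- to dv + ds ≤ 2N - 2. The surplus `ex` cancels: what is lost outside the cycle is gained on it.
  tally : ∀ P g p r o ex sv ov a b os dv ds N → P + g ≡ p + r → r ≤ g → N ≡ P + g + o →
          dv ≡ sv + ov → ds ≡ (a + b) + os → sv + 1 + ex ≤ P + 2 → ov + os + 2 ≤ o * 2 + ex →
          a + 1 ≤ p + 2 → b + 2 ≤ r * 2 → 2 * N ≤ dv + ds + 1 → ⊥
  tally P g p r o ex sv ov a b os dv ds N e₁ r≤g refl refl refl h₁ h₂ h₃ h₄ h =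
    <-irrefl refl (+-cancelʳ-< (4 + ex) _ _ (begin-strict
      2 * (P + g + o) + (4 + ex)                                        ≤⟨ +-monoˡ-≤ (4 + ex) h ⟩
      (sv + ov + (a + b + os) + 1) + (4 + ex)                           <⟨ n<1+n _ ⟩
      suc ((sv + ov + (a + b + os) + 1) + (4 + ex))                     ≡⟨ solve 6 (λ sv ov a b os ex → con 1 :+ ((sv :+ ov :+ (a :+ b :+ os) :+ con 1) :+ (con 4 :+ ex)) :=
                                                                              (sv :+ con 1 :+ ex) :+ (ov :+ os :+ con 2) :+ ((a :+ con 1) :+ (b :+ con 2))) refl sv ov a b os ex ⟩
      (sv + 1 + ex) + (ov + os + 2) + ((a + 1) + (b + 2))               ≤⟨ +-mono-≤ (+-mono-≤ h₁ h₂) (+-mono-≤ h₃ h₄) ⟩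
      (P + 2) + (o * 2 + ex) + ((p + 2) + r * 2)                        ≡⟨ solve 5 (λ P o ex p r → (P :+ con 2) :+ (o :* con 2 :+ ex) :+ ((p :+ con 2) :+ r :* con 2) :=
                                                                              (P :+ (p :+ r) :+ r :+ o :+ o) :+ (con 4 :+ ex)) refl P o ex p r ⟩
      (P + (p + r) + r + o + o) + (4 + ex)                              ≡⟨ cong (λ t → (P + t + r + o + o) + (4 + ex)) (sym e₁) ⟩
      (P + (P + g) + r + o + o) + (4 + ex)                              ≤⟨ +-monoˡ-≤ (4 + ex) (+-monoˡ-≤ o (+-monoˡ-≤ o (+-monoʳ-≤ (P + (P + g)) r≤g))) ⟩
      (P + (P + g) + g + o + o) + (4 + ex)                              ≡⟨ cong (_+ (4 + ex)) (solve 3 (λ P g o → P :+ (P :+ g) :+ g :+ o :+ o := con 2 :* (P :+ g :+ o)) refl P g o) ⟩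
      2 * (P + g + o) + (4 + ex)                                        ∎))
    where
    open +-*-Solver
    open ≤-Reasoning

-- One enlargement step of a cycle with vertex set S₀; ω are the vertices outside.  M excludes at most one
-- vertex x₀, and only vertices of M have to be kept.
module Enlarge {n} (D : Digraph n) (M : Fin n → Set) (M? : ∀ v → Dec (M v))
    (M-one : ∀ {q q'} → ¬ M q → ¬ M q' → q ≡ q')
    (S₀ ω : List (Fin n)) (unique : Unique (S₀ ++ ω))
    (dense : ∀ {u s} → u ∈ ω → s ∈ S₀ → M u → M s → ¬ Arc D u s → ¬ Arc D s u →
             2 * length (S₀ ++ ω) ≤ Σ[ adj D u ] (S₀ ++ ω) + Σ[ adj D s ] (S₀ ++ ω) + 1)
    (larger : ∀ {u l w m} → Path (Arc D) u l w → Arc D w u → Unique l → (∀ {v} → v ∈ l → v ∈ S₀ ++ ω) →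
              (∀ {v} → v ∈ S₀ → M v → v ∈ l) → m ∈ l → m ∈ ω → M m → ⊥) where

  private
    V = Fin n
    uniqueS = proj₁ (Unique-++⁻ S₀ unique)
    uniqueω = proj₁ (proj₂ (Unique-++⁻ S₀ unique))
    apart : ∀ {v} → v ∈ S₀ → v ∉ ω
    apart = proj₂ (proj₂ (Unique-++⁻ S₀ unique))

  Bypass : V → V → List V → Set
  Bypass a c β = ∃ λ b → ∃ λ b' → Arc D a b × Path (Arc D) b β b' × Arc D b' c ×
    (∀ {v} → v ∈ β → v ∈ ω) × Unique β × ∃ λ v → v ∈ β × M v

  -- An empty gap carries no arc because the bypass itself then closes the cycle.
  Gap : V → List V → V → Set
  Gap a γ c = (γ ≡ []) ⊎ ∃ λ g → ∃ λ g' → Arc D a g × Path (Arc D) g γ g' × Arc D g' c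

  private
    gapBefore : ∀ {a} γ₁ {s γ₂ c} → Gap a (γ₁ ++ s ∷ γ₂) c → Gap a γ₁ s × (∃ λ g' → Path (Arc D) s (s ∷ γ₂) g' × Arc D g' c)
    gapBefore [] (inj₂ (g , g' , ag , p , g'c)) with head≡ p
    ... | refl = inj₁ refl , g' , p , g'c
    gapBefore (t ∷ γ₁) {s} {γ₂} (inj₂ (g , g' , ag , p , g'c)) with splitPath (t ∷ γ₁) {s} {γ₂} p
    ... | p₁ , p₂ with initPath t γ₁ p₁
    ...   | h , r , f = inj₂ (g , h , ag , r , f) , g' , p₂ , g'c

    gapAfter : ∀ {a} γ₁ {s γ₂ c} → Gap a (γ₁ ++ s ∷ γ₂) c → Gap s γ₂ c × (∃ λ g → Arc D a g × Path (Arc D) g (γ₁ ++ s ∷ []) s)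
    gapAfter [] (inj₁ ())
    gapAfter (_ ∷ _) (inj₁ ())
    gapAfter γ₁ {s} {γ₂} (inj₂ (g , g' , ag , p , g'c)) with splitPath γ₁ p
    ... | p₁ , one = inj₁ refl , g , ag , p₁
    ... | p₁ , (e ◂ p₂) = inj₂ (_ , g' , e , p₂ , g'c) , g , ag , p₁

    shorter : ∀ (γ₁ : List V) {s γ₂} → length γ₁ < length (γ₁ ++ s ∷ γ₂) × length γ₂ < length (γ₁ ++ s ∷ γ₂)
    shorter γ₁ {s} {γ₂} rewrite length-++ γ₁ {s ∷ γ₂} =
      ≤-trans (≤-reflexive (+-comm 1 (length γ₁))) (+-monoʳ-≤ (length γ₁) (s≤s z≤n)) , m≤n+m (suc (length γ₂)) (length γ₁)

    closes : ∀ {c ρ a R β} → Path (Arc D) c ρ a → ρ ++ R ↭ S₀ → (∀ {s} → s ∈ R → ¬ M s) → Bypass a c β → ⊥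
    closes {ρ = ρ} {R = R} {β = β} p perm noM (b , b' , ab , q , b'c , β⊆ω , uβ , v , v∈ , mv) =
      larger (join p ab q) b'c
        (Unique-++⁺ (proj₁ (Unique-++⁻ ρ (Unique-resp-↭ (↭-sym perm) uniqueS))) uβ (λ { (m , m') → apart (ρ⊆ m) (β⊆ω m') }))
        sub keep (∈-++⁺ʳ ρ v∈) (β⊆ω v∈) mv
      where
      ρ⊆ : ∀ {t} → t ∈ ρ → t ∈ S₀
      ρ⊆ m = ∈-resp-↭ perm (∈-++⁺ˡ m)
      sub : ∀ {t} → t ∈ ρ ++ β → t ∈ S₀ ++ ω
      sub m with ∈-++⁻ ρ m
      ... | inj₁ x = ∈-++⁺ˡ (ρ⊆ x)
      ... | inj₂ x = ∈-++⁺ʳ S₀ (β⊆ω x)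
      keep : ∀ {t} → t ∈ S₀ → M t → t ∈ ρ ++ β
      keep m mt with ∈-++⁻ ρ (∈-resp-↭ (↭-sym perm) m)
      ... | inj₁ x = ∈-++⁺ˡ x
      ... | inj₂ x = ⊥-elim (noM x mt)

  -- A vertex v of M on a bypass of minimal gap γ, and the resulting degree bounds: ex = 1 allows x₀ to have
  -- three arcs with {v , s} at the price of one arc between v and the ends of ρ.
  module Count {c ρ a γ v} (ex : ℕ) (pρ : Path (Arc D) c ρ a) (gap : Gap a γ c) (perm : ρ ++ γ ↭ S₀)
      (v∈ω : v ∈ ω) (mv : M v) (ends : ex + (ε D v c + ε D a v) ≤ 2)
      (v↛γ : ∀ {s} → s ∈ γ → ¬ Arc D v s) (γ↛v : ∀ {s} → s ∈ γ → ¬ Arc D s v)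
      (outside : ∀ {s} → s ∈ γ → M s → Σ[ (λ q → adj D v q + adj D s q) ] ω + 2 ≤ length ω * 2 + ex) where

    private
      -- Inserting `v` into `ρ` and returning through the gap would give a larger cycle. The vertex
      -- `s` guarantees that the gap is non-empty and so has arcs to return along.
      rigid-gap : Gap a γ c → ∀ {s} → s ∈ γ → ¬ Insertable D v ρ
      rigid-gap (inj₁ γ≡[]) {s} s∈ ins with subst (s ∈_) γ≡[] s∈
      ... | ()
      rigid-gap (inj₂ (g , g' , ag , pγ , g'c)) s∈ ins with insert D pρ ins
      ... | ρ' , p' , perm' = larger (join p' ag pγ) g'c un sub keep (∈-++⁺ˡ (∈-resp-↭ (↭-sym perm') (here refl))) v∈ω mv
        where
        whole : ρ' ++ γ ↭ v ∷ S₀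
        whole = ↭-trans (↭-++⁺ʳ γ perm') (prep v perm)
        un : Unique (ρ' ++ γ)
        un = Unique-resp-↭ (↭-sym whole) (Unique-∷ (λ m → apart m v∈ω) uniqueS)
        sub : ∀ {t} → t ∈ ρ' ++ γ → t ∈ S₀ ++ ω
        sub m with ∈-resp-↭ whole m
        ... | here refl = ∈-++⁺ʳ S₀ v∈ω
        ... | there m' = ∈-++⁺ˡ m'
        keep : ∀ {t} → t ∈ S₀ → M t → t ∈ ρ' ++ γ
        keep m _ = ∈-resp-↭ (↭-sym whole) (there m)

      bad : ∀ {ρ' R s} → Path (Arc D) c ρ' a → ρ' ++ R ↭ S₀ → (∀ {t} → t ∈ R → t ∈ γ) → length R ≤ length γ →
            s ∈ R → M s → ¬ Insertable D s ρ' → ⊥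
      bad {ρ'} {R} {s} p' perm' R⊆ R≤ s∈R ms rigid =
        tally (length ρ) (length γ) (length ρ') (length R) (length ω) ex
          (Σ[ adj D v ] S₀) (Σ[ adj D v ] ω) (Σ[ adj D s ] ρ') (Σ[ adj D s ] R) (Σ[ adj D s ] ω)
          (Σ[ adj D v ] (S₀ ++ ω)) (Σ[ adj D s ] (S₀ ++ ω)) (length (S₀ ++ ω))
          (trans (sym (length-++ ρ)) (trans (↭-length perm) (trans (sym (↭-length perm')) (length-++ ρ'))))
          R≤
          (trans (length-++ S₀) (cong (_+ length ω) (trans (sym (↭-length perm)) (length-++ ρ))))
          (Σ-++ (adj D v) S₀ ω)
          (trans (Σ-++ (adj D s) S₀ ω) (cong (_+ Σ[ adj D s ] ω) (trans (sym (Σ-↭ (adj D s) perm')) (Σ-++ (adj D s) ρ' R))))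
          on-S
          (≤-trans (≤-reflexive (cong (_+ 2) (sym (Σ-+ (adj D v) (adj D s) ω)))) (outside s∈γ ms))
          (≤-trans (nonInsertable D p' rigid) (+-monoʳ-≤ (length ρ') (+-mono-≤ (ε≤1 D s c) (ε≤1 D a s))))
          (Σ-adj-self D s∈R)
          (dense v∈ω (∈-resp-↭ perm (∈-++⁺ʳ ρ s∈γ)) mv ms (v↛γ s∈γ) (γ↛v s∈γ))
        where
        s∈γ = R⊆ s∈R
        Σv : Σ[ adj D v ] S₀ ≡ Σ[ adj D v ] ρ
        Σv = trans (sym (Σ-↭ (adj D v) perm)) (trans (Σ-++ (adj D v) ρ γ)
               (trans (cong (Σ[ adj D v ] ρ +_) (Σ-zero (adj D v) γ (λ m → adj≡0 D (v↛γ m) (γ↛v m)))) (+-identityʳ _)))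
        on-S : Σ[ adj D v ] S₀ + 1 + ex ≤ length ρ + 2
        on-S rewrite Σv = ≤-trans (+-monoˡ-≤ ex (nonInsertable D pρ (rigid-gap gap s∈γ)))
          (≤-trans (≤-reflexive (trans (+-assoc (length ρ) _ ex) (cong (length ρ +_) (+-comm _ ex)))) (+-monoʳ-≤ (length ρ) ends))

      -- Insertions keep the ends `c` and `a`, so the bypass always closes `ρ'`. The process stops
      -- with no vertex of `M` left in `R`, which gives a larger cycle, or with one that cannot be
      -- inserted, which `bad` refutes by counting.
      absorb : ∀ k {ρ' R β} → length R ≤ k → Path (Arc D) c ρ' a → ρ' ++ R ↭ S₀ → (∀ {t} → t ∈ R → t ∈ γ) →
               length R ≤ length γ → Bypass a c β → ⊥
      absorb k {ρ'} {R} le p' perm' R⊆ R≤ by =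
        by-cases {P = ∃ λ s → s ∈ R × M s × Insertable D s ρ'} (absorb₁ k le)
          (λ rigid → closes p' perm' (λ {s} s∈ ms → bad p' perm' R⊆ R≤ s∈ ms (λ ins → rigid (s , s∈ , ms , ins))) by)
        where
        absorb₁ : ∀ k → length R ≤ k → (∃ λ s → s ∈ R × M s × Insertable D s ρ') → ⊥
        absorb₁ k le (s , s∈ , ms , ins) with ∈-∃++ s∈
        ... | R₁ , R₂ , refl with insert D p' ins
        ...   | ρ'' , p'' , perm'' = continue k le
          where
          len : length (R₁ ++ s ∷ R₂) ≡ suc (length (R₁ ++ R₂))
          len = ↭-length (shift s R₁ R₂)
          perm₂ : ρ'' ++ R₁ ++ R₂ ↭ S₀
          perm₂ = ↭-trans (↭-++⁺ʳ (R₁ ++ R₂) perm'') (↭-trans (↭-sym (shift s ρ' (R₁ ++ R₂)))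
                   (↭-trans (↭-++⁺ˡ ρ' (↭-sym (shift s R₁ R₂))) perm'))
          R⊆' : ∀ {t} → t ∈ R₁ ++ R₂ → t ∈ γ
          R⊆' m = R⊆ (∈-resp-↭ (↭-sym (shift s R₁ R₂)) (there m))
          continue : ∀ k → length (R₁ ++ s ∷ R₂) ≤ k → ⊥
          continue zero le with subst (_≤ 0) len le
          ... | ()
          continue (suc k) le = absorb k (s≤s⁻¹ (subst (_≤ suc k) len le)) p'' perm₂ R⊆' (≤-trans (n≤1+n _) (≤-trans (≤-reflexive (sym len)) R≤)) by

    impossible : ∀ {β} → Bypass a c β → ⊥
    impossible = absorb (length γ) ≤-refl pρ perm id ≤-refl

  private
    module Forms {c ρ a γ} (pρ : Path (Arc D) c ρ a) (gap : Gap a γ c) (perm : ρ ++ γ ↭ S₀)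
        (toGap : ∀ {s β} → s ∈ γ → Bypass a s β → ⊥) (fromGap : ∀ {s β} → s ∈ γ → Bypass s c β → ⊥) where

      pair : ∀ {p q : V} → p ≢ q → Unique (p ∷ q ∷ [])
      pair ne = Unique-∷ (λ { (here e) → ne e }) ([] ∷ [])

      two⊆ω : ∀ {p q} → p ∈ ω → q ∈ ω → ∀ {t} → t ∈ p ∷ q ∷ [] → t ∈ ω
      two⊆ω p∈ q∈ (here refl) = p∈
      two⊆ω p∈ q∈ (there (here refl)) = q∈

      -- The gain of 2 comes from `v` itself, which lies in `ω` and is adjacent neither to itself
      -- nor to `s`.
      outside : ∀ {v s} ex → v ∈ ω → s ∈ γ → ¬ Arc D v s → ¬ Arc D s v →
        (∀ {q} → q ∈ ω → q ≢ v → M q → adj D v q + adj D s q ≤ 2) →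
        (∀ {q} → q ∈ ω → q ≢ v → adj D v q + adj D s q ≤ 2 + ex) →
        Σ[ (λ q → adj D v q + adj D s q) ] ω + 2 ≤ length ω * 2 + ex
      outside {v} {s} ex v∈ s∈ v↛s s↛v h h' with pull v∈
      ... | ω' , p = begin
          Σ[ f ] ω + 2                 ≡⟨ cong (_+ 2) (Σ-↭ f p) ⟩
          f v + Σ[ f ] ω' + 2          ≡⟨ cong (λ t → t + Σ[ f ] ω' + 2) (cong₂ _+_ (adj-self D v) (adj≡0 D s↛v v↛s)) ⟩
          Σ[ f ] ω' + 2                ≤⟨ +-monoˡ-≤ 2 (Σ-atmost M M? f 2 ex ω' (Unique-tail un') M-one
                                            (λ m → h (in-ω m) (not-v m)) (λ m → h' (in-ω m) (not-v m))) ⟩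
          length ω' * 2 + ex + 2       ≡⟨ solve 2 (λ a b → a :+ b :+ con 2 := con 2 :+ a :+ b) refl (length ω' * 2) ex ⟩
          suc (length ω') * 2 + ex     ≡⟨ cong (λ t → t * 2 + ex) (sym (↭-length p)) ⟩
          length ω * 2 + ex            ∎
        where
        open +-*-Solver
        open ≤-Reasoning
        f : V → ℕ
        f q = adj D v q + adj D s q
        un' : Unique (v ∷ ω')
        un' = Unique-resp-↭ p uniqueω
        in-ω : ∀ {q} → q ∈ ω' → q ∈ ω
        in-ω m = ∈-resp-↭ (↭-sym p) (there m)
        not-v : ∀ {q} → q ∈ ω' → q ≢ v
        not-v m refl = Unique[x∷xs]⇒x∉xs un' m

      -- For every `q`, exempt or not, `v → q → s` and `s → q → v` would both yield a bypass of a
      -- shorter gap; so no surplus arises and `ex` is 0.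
      oneVertex : ∀ {v} → Arc D a v → Arc D v c → v ∈ ω → M v → ⊥
      oneVertex {v} av vc v∈ mv =
        Count.impossible 0 pρ gap perm v∈ mv (+-mono-≤ (ε≤1 D v c) (ε≤1 D a v)) v↛ ↛v
          (λ s∈ ms → outside 0 v∈ s∈ (v↛ s∈) (↛v s∈) (λ q∈ ne _ → both s∈ q∈ ne) (both s∈))
          (v , v , av , one , vc , sub₁ , [] ∷ [] , v , here refl , mv)
        where
        sub₁ : ∀ {t} → t ∈ v ∷ [] → t ∈ ω
        sub₁ (here refl) = v∈
        v↛ : ∀ {s} → s ∈ γ → ¬ Arc D v s
        v↛ s∈ vs = toGap s∈ (v , v , av , one , vs , sub₁ , [] ∷ [] , v , here refl , mv)
        ↛v : ∀ {s} → s ∈ γ → ¬ Arc D s v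
        ↛v s∈ sv = fromGap s∈ (v , v , sv , one , vc , sub₁ , [] ∷ [] , v , here refl , mv)
        both : ∀ {s} → s ∈ γ → ∀ {q} → q ∈ ω → q ≢ v → adj D v q + adj D s q ≤ 2
        both s∈ {q} q∈ ne = adj₂≤2 D
          (λ vq qs → toGap s∈ (v , q , av , vq ◂ one , qs , two⊆ω v∈ q∈ , pair (ne ∘ sym) , v , here refl , mv))
          (λ sq qv → fromGap s∈ (q , v , sq , qv ◂ one , vc , two⊆ω q∈ v∈ , pair ne , v , there (here refl) , mv))

      -- If `q` is already on the bypass, the arc `s → q` joins it further along and skips `v`; the
      -- remainder is a bypass because `q` is in `M`.
      enter : ∀ {v β b'} → Path (Arc D) v (v ∷ β) b' → Arc D b' c → (∀ {t} → t ∈ v ∷ β → t ∈ ω) → Unique (v ∷ β) → M v →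
              ∀ {s q} → s ∈ γ → q ∈ ω → q ≢ v → M q → Arc D s q → Arc D q v → ⊥
      enter {v} {β} p b'c sub un mv {s} {q} s∈ q∈ ne mq sq qv with q ∈? β
      ... | no q∉ = fromGap s∈ (q , _ , sq , qv ◂ p , b'c , (λ { (here refl) → q∈ ; (there m) → sub m }) ,
                      Unique-∷ (∉-∷ ne q∉) un , q , here refl , mq)
      ... | yes q∈β with ∈-∃++ q∈β
      ...   | β₁ , β₂ , refl = fromGap s∈ (q , _ , sq , proj₂ (splitPath (v ∷ β₁) p) , b'c ,
                (λ m → sub (∈-++⁺ʳ (v ∷ β₁) m)) , proj₁ (proj₂ (Unique-++⁻ (v ∷ β₁) un)) , q , here refl , mq)

      -- For exempt `q` only `v → q → s` is excluded: if `q` is on the bypass, what follows it may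
      -- contain no vertex of `M`. This one extra arc is paid for by the missing arc `v → c`.
      startsInM : ∀ {v β b'} → Arc D a v → Path (Arc D) v (v ∷ β) b' → Arc D b' c → (∀ {t} → t ∈ v ∷ β → t ∈ ω) →
                  Unique (v ∷ β) → M v → ⊥
      startsInM {v} {β} {b'} av p b'c sub un mv with arc? D v c
      ... | yes vc = oneVertex av vc (sub (here refl)) mv
      ... | no v↛c =
        Count.impossible 1 pρ gap perm v∈ mv ends v↛ ↛v
          (λ s∈ ms → outside 1 v∈ s∈ (v↛ s∈) (↛v s∈)
             (λ q∈ ne mq → adj₂≤2 D (leave s∈ q∈ ne) (enter p b'c sub un mv s∈ q∈ ne mq))
             (λ q∈ ne → adj₂≤3 D (inj₁ (leave s∈ q∈ ne))))
          (v , b' , av , p , b'c , sub , un , v , here refl , mv)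
        where
        v∈ = sub (here refl)
        ends : 1 + (ε D v c + ε D a v) ≤ 2
        ends rewrite ε≡0 D v↛c = s≤s (ε≤1 D a v)
        v↛ : ∀ {s} → s ∈ γ → ¬ Arc D v s
        v↛ s∈ vs = toGap s∈ (v , v , av , one , vs , (λ { (here refl) → v∈ }) , [] ∷ [] , v , here refl , mv)
        ↛v : ∀ {s} → s ∈ γ → ¬ Arc D s v
        ↛v s∈ sv = fromGap s∈ (v , b' , sv , p , b'c , sub , un , v , here refl , mv)
        leave : ∀ {s q} → s ∈ γ → q ∈ ω → q ≢ v → Arc D v q → Arc D q s → ⊥
        leave s∈ q∈ ne vq qs = toGap s∈ (v , _ , av , vq ◂ one , qs , two⊆ω v∈ q∈ , pair (ne ∘ sym) , v , here refl , mv)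

      -- For `q = x₀` only `s → q → v` is excluded, since `a → x₀ → v → x₀ → s` repeats a vertex.
      -- The extra arc is paid for by the missing arc `a → v`.
      startsOutsideM : ∀ {x₀ v β b'} → ¬ M x₀ → Arc D a x₀ → Arc D x₀ v → Path (Arc D) v (v ∷ β) b' → Arc D b' c →
                       (∀ {t} → t ∈ x₀ ∷ v ∷ β → t ∈ ω) → Unique (x₀ ∷ v ∷ β) → M v → ⊥
      startsOutsideM {x₀} {v} {β} {b'} ¬mx ax xv p b'c sub un mv with arc? D a v
      ... | yes av = startsInM av p b'c (sub ∘ there) (Unique-tail un) mv
      ... | no a↛v =
        Count.impossible 1 pρ gap perm v∈ mv ends v↛ ↛v
          (λ s∈ ms → outside 1 v∈ s∈ (v↛ s∈) (↛v s∈)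
             (λ q∈ ne mq → adj₂≤2 D (leave s∈ q∈ ne mq) (enter p b'c (sub ∘ there) (Unique-tail un) mv s∈ q∈ ne mq))
             (λ {q} q∈ ne → adj₂≤3 D (some s∈ q∈ ne (M? q))))
          (x₀ , b' , ax , xv ◂ p , b'c , sub , un , v , there (here refl) , mv)
        where
        v∈ = sub (there (here refl))
        x∈ = sub (here refl)
        x≢v : x₀ ≢ v
        x≢v refl = ¬mx mv
        ends : 1 + (ε D v c + ε D a v) ≤ 2
        ends rewrite ε≡0 D a↛v = s≤s (≤-trans (≤-reflexive (+-identityʳ _)) (ε≤1 D v c))
        v↛ : ∀ {s} → s ∈ γ → ¬ Arc D v s
        v↛ s∈ vs = toGap s∈ (x₀ , v , ax , xv ◂ one , vs , two⊆ω x∈ v∈ , pair x≢v , v , there (here refl) , mv)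
        ↛v : ∀ {s} → s ∈ γ → ¬ Arc D s v
        ↛v s∈ sv = fromGap s∈ (v , b' , sv , p , b'c , sub ∘ there , Unique-tail un , v , here refl , mv)
        leave : ∀ {s q} → s ∈ γ → q ∈ ω → q ≢ v → M q → Arc D v q → Arc D q s → ⊥
        leave s∈ q∈ ne mq vq qs = toGap s∈ (x₀ , _ , ax , xv ◂ vq ◂ one , qs ,
          (λ { (here refl) → x∈ ; (there m) → two⊆ω v∈ q∈ m }) ,
          Unique-∷ (∉-∷ x≢v (λ { (here refl) → ¬mx mq })) (pair (ne ∘ sym)) , v , there (here refl) , mv)
        some : ∀ {s q} → s ∈ γ → q ∈ ω → q ≢ v → Dec (M q) →
               (Arc D v q → Arc D q s → ⊥) ⊎ (Arc D s q → Arc D q v → ⊥)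
        some s∈ q∈ ne (yes mq) = inj₁ (leave s∈ q∈ ne mq)
        some s∈ q∈ ne (no ¬mq) with M-one ¬mq ¬mx
        ... | refl = inj₂ λ sx xv → fromGap s∈ (x₀ , b' , sx , xv ◂ p , b'c , sub , un , v , there (here refl) , mv)

      noBypass : ∀ {β} → Bypass a c β → ⊥
      noBypass (b , b' , ab , p , b'c , sub , un , v , v∈ , mv) = start p v∈ ab sub un
        where
        start : ∀ {b β} → Path (Arc D) b β b' → v ∈ β → Arc D a b → (∀ {t} → t ∈ β → t ∈ ω) → Unique β → ⊥
        start {b} one (here refl) ab sub un = startsInM ab one b'c sub un mv
        start {b} (e ◂ p) v∈ ab sub un with M? b
        ... | yes mb = startsInM ab (e ◂ p) b'c sub un mb
        start {b} (e ◂ one) (here refl) ab sub un | no ¬mb = ¬mb mv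
        start {b} (e ◂ one) (there (here refl)) ab sub un | no ¬mb = startsOutsideM ¬mb ab e one b'c sub un mv
        start {b} (e ◂ (_◂_ {u = u} f p)) v∈ ab sub un | no ¬mb with M? u
        ... | yes mu = startsOutsideM ¬mb ab e (f ◂ p) b'c sub un mu
        ... | no ¬mu = Unique[x∷xs]⇒x∉xs un (here (M-one ¬mb ¬mu))

  -- Induction on the length of the gap: replacing one end of the bypass by a vertex of `γ` shortens
  -- the gap, the skipped part of `γ` joining `ρ`.
  noBypass : ∀ k {c ρ a γ β} → length γ < k → Path (Arc D) c ρ a → Gap a γ c → ρ ++ γ ↭ S₀ → Bypass a c β → ⊥
  noBypass (suc k) {c} {ρ} {a} {γ} (s≤s lt) pρ gap perm = Forms.noBypass pρ gap perm toGap fromGap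
    where
    toGap : ∀ {s β} → s ∈ γ → Bypass a s β → ⊥
    toGap {s} s∈ by with ∈-∃++ s∈
    ... | γ₁ , γ₂ , refl with gapBefore γ₁ gap
    ...   | gap₁ , g' , p , g'c = noBypass k (≤-trans (proj₁ (shorter γ₁)) lt) (join p g'c pρ) gap₁
              (↭-trans (↭-++-comm ((s ∷ γ₂) ++ ρ) γ₁)
                (↭-trans (↭-reflexive (sym (++-assoc γ₁ (s ∷ γ₂) ρ))) (↭-trans (↭-++-comm (γ₁ ++ s ∷ γ₂) ρ) perm))) by
    fromGap : ∀ {s β} → s ∈ γ → Bypass s c β → ⊥
    fromGap {s} s∈ by with ∈-∃++ s∈
    ... | γ₁ , γ₂ , refl with gapAfter γ₁ gap
    ...   | gap₂ , g , ag , p = noBypass k (≤-trans (proj₂ (shorter γ₁)) lt) (join pρ ag p) gap₂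
              (↭-trans (↭-reflexive (trans (++-assoc ρ (γ₁ ++ s ∷ []) γ₂) (cong (ρ ++_) (++-assoc γ₁ (s ∷ []) γ₂)))) perm) by

rotateTo : ∀ {V : Set} {E : V → V → Set} {u l w c} → Path E u l w → E w u → c ∈ l →
           ∃ λ l' → ∃ λ w' → Path E c l' w' × E w' c × l' ↭ l
rotateTo p wu c∈ with ∈-∃++ c∈
rotateTo p wu c∈ | [] , l₂ , refl with head≡ p
... | refl = _ , _ , p , wu , ↭-refl
rotateTo {c = c} p wu c∈ | t ∷ l₁ , l₂ , refl with splitPath (t ∷ l₁) p
... | p₁ , p₂ with initPath t l₁ p₁
...   | h , q , hc = (c ∷ l₂) ++ t ∷ l₁ , h , join p₂ wu q , hc , ↭-++-comm (c ∷ l₂) (t ∷ l₁)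

-- Cycles through all vertices of `M`

module Cover {n} (D : Digraph n) (vs : List (Fin n)) (unique : Unique vs)
    (strong : ∀ {u w} → u ∈ vs → w ∈ vs → ∃ λ l → Path (Arc D) u l w × (∀ {v} → v ∈ l → v ∈ vs))
    (M : Fin n → Set) (M? : ∀ v → Dec (M v)) (M-one : ∀ {q q'} → ¬ M q → ¬ M q' → q ≡ q')
    (K : Fin n → Set) (K⊆M : ∀ {v} → K v → M v)
    (dense : ∀ {u s} → u ∈ vs → s ∈ vs → M u → M s → ¬ K u → u ≢ s → ¬ Arc D u s → ¬ Arc D s u →
             2 * length vs ≤ Σ[ adj D u ] vs + Σ[ adj D s ] vs + 1)
    (covered : ∀ {u l w} → Path (Arc D) u l w → Arc D w u → Unique l → (∀ {v} → v ∈ l → v ∈ vs) →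
               (∀ {v} → v ∈ vs → M v → v ∈ l) → ⊥) where

  private
    V = Fin n

    module Step {u l w} (cyc : Path (Arc D) u l w) (wu : Arc D w u) (un : Unique l) (K⊆l : ∀ {v} → K v → v ∈ l)
        (ω : List V) (perm : l ++ ω ↭ vs)
        (larger : ∀ {u l' w m} → Path (Arc D) u l' w → Arc D w u → Unique l' → (∀ {v} → v ∈ l' → v ∈ vs) →
                  (∀ {v} → v ∈ l → M v → v ∈ l') → m ∈ l' → m ∉ l → M m → ⊥) where

      unω : Unique (l ++ ω)
      unω = Unique-resp-↭ (↭-sym perm) unique
      apart : ∀ {v} → v ∈ l → v ∉ ω
      apart = proj₂ (proj₂ (Unique-++⁻ l unω))
      in-vs : ∀ {v} → v ∈ l ++ ω → v ∈ vs
      in-vs = ∈-resp-↭ perm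
      in-ω : ∀ {v} → v ∈ vs → v ∉ l → v ∈ ω
      in-ω m v∉ with ∈-++⁻ l (∈-resp-↭ (↭-sym perm) m)
      ... | inj₁ a = ⊥-elim (v∉ a)
      ... | inj₂ b = b

      dense' : ∀ {u s} → u ∈ ω → s ∈ l → M u → M s → ¬ Arc D u s → ¬ Arc D s u →
               2 * length (l ++ ω) ≤ Σ[ adj D u ] (l ++ ω) + Σ[ adj D s ] (l ++ ω) + 1
      dense' {u} {s} u∈ s∈ mu ms us su rewrite ↭-length perm | Σ-↭ (adj D u) perm | Σ-↭ (adj D s) perm =
        dense (in-vs (∈-++⁺ʳ l u∈)) (in-vs (∈-++⁺ˡ s∈)) mu ms (λ k → apart (K⊆l k) u∈) (λ { refl → apart s∈ u∈ }) us su

      module E = Enlarge D M M? M-one l ω unω dense'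
        (λ p e u' sub keep m∈ m∈ω mm → larger p e u' (in-vs ∘ sub) keep m∈ (λ m∈l → apart m∈l m∈ω) mm)

      -- The case `a = c` is included: `ρ` is then a single vertex and the gap is the rest of the
      -- cycle.
      noBypass : ∀ {a c β} → a ∈ l → c ∈ l → E.Bypass a c β → ⊥
      noBypass {a} {c} a∈ c∈ by with rotateTo cyc wu c∈
      ... | l' , w' , p , w'c , perm' with ∈-∃++ (∈-resp-↭ (↭-sym perm') a∈)
      ...   | r₁ , [] , refl = E.noBypass 1 (s≤s z≤n) (proj₁ (splitPath r₁ p)) (inj₁ refl)
                (subst (_↭ l) (sym (++-identityʳ (r₁ ++ a ∷ []))) perm') by
      ...   | r₁ , g ∷ r₂ , refl with consecutive r₁ p
      ...     | p₁ , ag , p₂ = E.noBypass (suc (suc (length r₂))) ≤-refl p₁ (inj₂ (_ , _ , ag , p₂ , w'c))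
                  (subst (_↭ l) (sym (++-assoc r₁ (a ∷ []) (g ∷ r₂))) perm') by

      -- A path from `m` to the cycle, stopped at its first vertex there, prolongs the arc `s → m`
      -- to a bypass.
      no-out : ∀ {s m} → s ∈ l → m ∈ ω → M m → ¬ Arc D s m
      no-out {s} {m} s∈ m∈ mm sm with strong (in-vs (∈-++⁺ʳ l m∈)) (in-vs (∈-++⁺ˡ s∈))
      ... | l₁ , p , sub with trimEnd (_∈? l) p (last∈ p) s∈
      ...   | c , l₂ , c∈ , q , sub₂ , only with simple q
      ...     | _ , one , _ , _ = apart c∈ m∈
      ...     | _ ∷ l₃ , (e ◂ r) , un₃ , sub₃ = go (snoc-view r)
        where
        snoc-view : ∀ {u l w} → Path (Arc D) u l w → ∃ λ l' → l ≡ l' ++ w ∷ []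
        snoc-view one = [] , refl
        snoc-view (_◂_ {u = u} _ p) with snoc-view p
        ... | l' , refl = u ∷ l' , refl
        go : ∃ (λ l' → l₃ ≡ l' ++ c ∷ []) → ⊥
        go (l' , refl) with initPath m l' (e ◂ r)
        ... | h , q' , hc = noBypass s∈ c∈ (m , h , sm , q' , hc , β⊆ω , proj₁ (Unique-++⁻ (m ∷ l') un₃) , m , here refl , mm)
          where
          β⊆ω : ∀ {t} → t ∈ m ∷ l' → t ∈ ω
          β⊆ω {t} t∈ = in-ω (sub (sub₂ (sub₃ (∈-++⁺ˡ t∈)))) λ t∈l →
            proj₂ (proj₂ (Unique-++⁻ (m ∷ l') un₃)) t∈ (here (only (sub₃ (∈-++⁺ˡ t∈)) t∈l))

      no-in : ∀ {s m} → s ∈ l → m ∈ ω → M m → ¬ Arc D m s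
      no-in {s} {m} s∈ m∈ mm ms with strong (in-vs (∈-++⁺ˡ s∈)) (in-vs (∈-++⁺ʳ l m∈))
      ... | l₁ , p , sub with trimStart (_∈? l) p (first∈ p) s∈
      ...   | a , l₂ , a∈ , q , sub₂ , only with simple q
      ...     | _ , one , _ , _ = apart a∈ m∈
      ...     | _ ∷ l₃ , (e ◂ r) , un₃ , sub₃ = noBypass a∈ s∈ (_ , m , e , r , ms , β⊆ω , Unique-tail un₃ , m , last∈ r , mm)
        where
        β⊆ω : ∀ {t} → t ∈ l₃ → t ∈ ω
        β⊆ω {t} t∈ = in-ω (sub (sub₂ (sub₃ (there t∈)))) λ t∈l →
          Unique[x∷xs]⇒x∉xs un₃ (subst (_∈ l₃) (only (sub₃ (there t∈)) t∈l) t∈)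

      -- With L vertices on the cycle and O outside, `m` has at most 2O - 2 arcs, none of them with
      -- the cycle, and `s` has at most 2L - 2 arcs on the cycle and two outside, both with the
      -- exempt vertex. The sum 2(L + O) - 2 is one short of the density bound.
      separated : ∀ {s m} → s ∈ l → M s → m ∈ ω → M m → ⊥
      separated {s} {m} s∈ ms m∈ mm = <-irrefl refl (begin-strict
          2 * (L + O)                                 ≡⟨ cong (2 *_) (sym (length-++ l)) ⟩
          2 * length (l ++ ω)                         ≤⟨ dense' m∈ s∈ mm ms (no-in s∈ m∈ mm) (no-out s∈ m∈ mm) ⟩
          Σ[ adj D m ] (l ++ ω) + Σ[ adj D s ] (l ++ ω) + 1
             ≡⟨ cong₂ (λ a b → a + b + 1) (trans (Σ-++ (adj D m) l ω) (cong (_+ Σ[ adj D m ] ω) (Σ-zero (adj D m) l (λ t∈ → adj≡0 D (no-in t∈ m∈ mm) (no-out t∈ m∈ mm)))))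
                                          (Σ-++ (adj D s) l ω) ⟩
          A + (B + C) + 1                             <⟨ ≤-reflexive (solve 3 (λ a b c → con 1 :+ (a :+ (b :+ c) :+ con 1) := a :+ (b :+ c) :+ con 2) refl A B C) ⟩
          A + (B + C) + 2                             ≤⟨ +-cancelʳ-≤ 2 _ _ bound ⟩
          2 * (L + O)                                 ∎)
        where
        open +-*-Solver
        open ≤-Reasoning
        L = length l
        O = length ω
        A = Σ[ adj D m ] ω
        B = Σ[ adj D s ] l
        C = Σ[ adj D s ] ω
        C≤2 : C ≤ 2
        C≤2 = ≤-trans (Σ-atmost M M? (adj D s) 0 2 ω (proj₁ (proj₂ (Unique-++⁻ l unω))) M-one
                (λ q∈ mq → ≤-reflexive (adj≡0 D (no-out s∈ q∈ mq) (no-in s∈ q∈ mq))) (λ {q} _ → adj≤2 D s q))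
                (≤-reflexive (cong (_+ 2) (*-zeroʳ O)))
        bound : A + (B + C) + 2 + 2 ≤ 2 * (L + O) + 2
        bound = begin
          A + (B + C) + 2 + 2          ≡⟨ solve 3 (λ a b c → a :+ (b :+ c) :+ con 2 :+ con 2 := (a :+ con 2) :+ (b :+ con 2) :+ c) refl A B C ⟩
          (A + 2) + (B + 2) + C        ≤⟨ +-mono-≤ (+-mono-≤ (Σ-adj-self D m∈) (Σ-adj-self D s∈)) C≤2 ⟩
          O * 2 + L * 2 + 2            ≡⟨ solve 2 (λ o l → o :* con 2 :+ l :* con 2 :+ con 2 := con 2 :* (l :+ o) :+ con 2) refl O L ⟩
          2 * (L + O) + 2              ∎

      noneMissing : ∀ {m} → m ∈ ω → M m → ⊥
      -- The arc `w → u` makes the two ends distinct, so at least one of them is in `M`.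
      noneMissing m∈ mm with M? u
      ... | yes mu = separated (first∈ cyc) mu m∈ mm
      ... | no ¬mu with M? w
      ...   | yes mw = separated (last∈ cyc) mw m∈ mm
      ...   | no ¬mw with M-one ¬mu ¬mw
      ...     | refl = no-loop D wu

  -- The measure counts the vertices of `M` on the cycle and not its length, because an enlargement
  -- may lose the exempt vertex.
  cover : ∀ k {u l w} → length vs < k + length (filter M? l) → Path (Arc D) u l w → Arc D w u → Unique l →
          (∀ {v} → v ∈ l → v ∈ vs) → (∀ {v} → K v → v ∈ l) → ⊥
  cover zero {l = l} lt cyc wu un sub K⊆l = <-irrefl refl (≤-trans lt (Unique-⊆-length (Unique-filter⁺ M? un) (λ m → sub (proj₁ (∈-filter⁻ M? m)))))
  cover (suc k) {l = l} lt cyc wu un sub K⊆l with complement un sub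
  ... | ω , perm = by-cases {P = ∃ λ m → m ∈ ω × M m}
        (λ { (m , m∈ , mm) → Step.noneMissing cyc wu un K⊆l ω perm larger m∈ mm })
        (λ empty → covered cyc wu un sub (all empty))
    where
    all : ¬ (∃ λ m → m ∈ ω × M m) → ∀ {v} → v ∈ vs → M v → v ∈ l
    all empty m mv with ∈-++⁻ l (∈-resp-↭ (↭-sym perm) m)
    ... | inj₁ a = a
    ... | inj₂ b = ⊥-elim (empty (_ , b , mv))
    larger : ∀ {u l' w m} → Path (Arc D) u l' w → Arc D w u → Unique l' → (∀ {v} → v ∈ l' → v ∈ vs) →
             (∀ {v} → v ∈ l → M v → v ∈ l') → m ∈ l' → m ∉ l → M m → ⊥
    larger {l' = l'} {m = m} p e un' sub' keep m∈ m∉ mm = cover k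
      (≤-trans lt (≤-trans (≤-reflexive (sym (+-suc k _))) (+-monoʳ-≤ k more))) p e un' sub' (λ kv → keep (K⊆l kv) (K⊆M kv))
      where
      more : suc (length (filter M? l)) ≤ length (filter M? l')
      more = Unique-⊆-length (Unique-∷ (λ m∈l → m∉ (proj₁ (∈-filter⁻ M? m∈l))) (Unique-filter⁺ M? un))
        λ { (here refl) → ∈-filter⁺ M? m∈ mm
          ; (there v∈) → let v∈l , mv = ∈-filter⁻ M? {xs = l} v∈ in ∈-filter⁺ M? (keep v∈l mv) mv }

-- Cycles of all lengths

lookup-injective : ∀ {V : Set} {l : List V} → Unique l → ∀ {i j} → lookup l i ≡ lookup l j → i ≡ j
lookup-injective {l = _ ∷ _} un {zero} {zero} e = refl
lookup-injective {l = _ ∷ l} un {zero} {suc j} e = ⊥-elim (Unique[x∷xs]⇒x∉xs un (subst (_∈ l) (sym e) (∈-lookup j)))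
lookup-injective {l = _ ∷ l} un {suc i} {zero} e = ⊥-elim (Unique[x∷xs]⇒x∉xs un (subst (_∈ l) e (∈-lookup i)))
lookup-injective {l = _ ∷ _} (_ ∷ un) {suc i} {suc j} e = cong suc (lookup-injective un e)

module _ {V : Set} {E : V → V → Set} where

  lookup-arc : ∀ {u l w} → Path E u l w → ∀ i j → toℕ j ≡ suc (toℕ i) → E (lookup l i) (lookup l j)
  lookup-arc one zero zero ()
  lookup-arc (e ◂ one) zero (suc zero) _ = e
  lookup-arc (e ◂ (_ ◂ _)) zero (suc zero) _ = e
  lookup-arc (e ◂ p) (suc i) (suc j) eq = lookup-arc p i j (suc-injective eq)

  lookup-last : ∀ {u l w} → Path E u l w → ∀ i → suc (toℕ i) ≡ length l → lookup l i ≡ w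
  lookup-last one zero _ = refl
  lookup-last (e ◂ one) zero ()
  lookup-last (e ◂ (_ ◂ _)) zero ()
  lookup-last (e ◂ p) (suc i) eq = lookup-last p i (suc-injective eq)

module _ {n} (D : Digraph n) where

  Cycle : List (Fin n) → Set
  Cycle l = ∃ λ u → ∃ λ w → Path (Arc D) u l w × Arc D w u × Unique l

  hasCycle : ∀ {l} → Cycle l → HasCycle D (length l)
  hasCycle {[]} (_ , _ , () , _)
  hasCycle {v ∷ l} (u , w , p , wu , un) = lookup (v ∷ l) , lookup-injective un , arcs
    where
    arcs : ∀ i → Arc D (lookup (v ∷ l) i) (lookup (v ∷ l) (nextF i))
    arcs i with toℕ i <? length l
    ... | yes lt = lookup-arc p i (fromℕ< (s≤s lt)) (toℕ-fromℕ< (s≤s lt))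
    ... | no ge with lookup-last p i (cong suc (≤-antisym (s≤s⁻¹ (toℕ<n i)) (≮⇒≥ ge))) | head≡ p
    ...   | e | refl rewrite e = wu

  private
    any-vec? : ∀ k {P : Vec (Fin n) k → Set} → (∀ v → Dec (P v)) → Dec (∃ P)
    any-vec? zero P? with P? []
    ... | yes p = yes ([] , p)
    ... | no ¬p = no λ { ([] , p) → ¬p p }
    any-vec? (suc k) P? with anyFin? (λ h → any-vec? k (λ t → P? (h ∷ t)))
    ... | yes (h , t , p) = yes (h ∷ t , p)
    ... | no ¬p = no λ { (h ∷ t , p) → ¬p (h , t , p) }

    IsCycle : ∀ {k} → (Fin (suc k) → Fin n) → Set
    IsCycle c = (∀ i j → c i ≡ c j → i ≡ j) × (∀ i → Arc D (c i) (c (nextF i)))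

    isCycle? : ∀ {k} (c : Fin (suc k) → Fin n) → Dec (IsCycle c)
    isCycle? c = all? (λ i → all? λ j → (c i ≟ c j) →-dec (i ≟ j)) ×-dec all? (λ i → arc? D (c i) (c (nextF i)))

  hasCycle-stable : ∀ m → (¬ HasCycle D m → ⊥) → HasCycle D m
  hasCycle-stable zero h = h (λ ())
  hasCycle-stable (suc k) h with any-vec? (suc k) (λ v → isCycle? (Vec.lookup v))
  ... | yes (v , inj , arcs) = Vec.lookup v , (λ {i} {j} → inj i j) , arcs
  ... | no ¬c = ⊥-elim (h λ { (c , inj , arcs) → ¬c (Vec.tabulate c ,
          (λ i j e → inj (trans (sym (lookup∘tabulate c i)) (trans e (lookup∘tabulate c j)))) ,
          λ i → subst₂ (Arc D) (sym (lookup∘tabulate c i)) (sym (lookup∘tabulate c (nextF i))) (arcs i)) })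

-- Cyclic counting by rotations

S[_] : (ℕ → ℕ) → ℕ → ℕ
S[ g ] zero = 0
S[ g ] (suc L) = g 0 + S[ g ∘ suc ] L

S-bound : ∀ (f g : ℕ → ℕ) L → (∀ i → f i + g i ≤ 1) → S[ f ] L + S[ g ] L ≤ L
S-bound f g zero h = z≤n
S-bound f g (suc L) h = ≤-trans
  (≤-reflexive (solve 4 (λ a b c d → a :+ b :+ (c :+ d) := (a :+ c) :+ (b :+ d)) refl (f 0) (S[ f ∘ suc ] L) (g 0) (S[ g ∘ suc ] L)))
  (+-mono-≤ (h 0) (S-bound (f ∘ suc) (g ∘ suc) L (h ∘ suc)))
  where open +-*-Solver

module _ {V : Set} where

  rot : List V → List V
  rot [] = []
  rot (x ∷ l) = l ++ x ∷ []

  rots : ℕ → List V → List V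
  rots zero l = l
  rots (suc i) l = rots i (rot l)

  rots-comm : ∀ i l → rots i (rot l) ≡ rot (rots i l)
  rots-comm zero l = refl
  rots-comm (suc i) l = rots-comm i (rot l)

  rots-swap : ∀ i j l → rots i (rots j l) ≡ rots j (rots i l)
  rots-swap zero j l = refl
  rots-swap (suc i) j l = trans (cong (rots i) (sym (rots-comm j l))) (rots-swap i j (rot l))

  rots-++ : ∀ (P : List V) R → rots (length P) (P ++ R) ≡ R ++ P
  rots-++ [] R = sym (++-identityʳ R)
  rots-++ (x ∷ P) R = trans (cong (rots (length P)) (++-assoc P R (x ∷ []))) (trans (rots-++ P (R ++ x ∷ [])) (++-assoc R (x ∷ []) P))

  rot-↭ : ∀ l → rot l ↭ l
  rot-↭ [] = ↭-refl
  rot-↭ (x ∷ l) = ↭-++-comm l (x ∷ [])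

  rots-↭ : ∀ i l → rots i l ↭ l
  rots-↭ zero l = ↭-refl
  rots-↭ (suc i) l = ↭-trans (rots-↭ i (rot l)) (rot-↭ l)

  hd : V → List V → V
  hd z [] = z
  hd z (x ∷ _) = x

  -- `ys` holds the entries already moved to the back. The list is non-empty at each index counted,
  -- so the default `z` of `hd` is never read.
  S-rots : ∀ z (f : V → ℕ) xs ys → S[ (λ i → f (hd z (rots i (xs ++ ys)))) ] (length xs) ≡ Σ[ f ] xs
  S-rots z f [] ys = refl
  S-rots z f (x ∷ xs) ys rewrite ++-assoc xs ys (x ∷ []) = cong (f x +_) (S-rots z f xs (ys ++ x ∷ []))

  split-at : ∀ k (l : List V) → k < length l → ∃ λ P → ∃ λ y → ∃ λ Q → l ≡ P ++ y ∷ Q × length P ≡ k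
  split-at zero (y ∷ l) _ = [] , y , l , refl , refl
  split-at (suc k) (x ∷ l) (s≤s lt) with split-at k l lt
  ... | P , y , Q , refl , e = x ∷ P , y , Q , refl , cong suc e

module _ {n} (D : Digraph n) where

  Cycle-rot : ∀ {l} → Cycle D l → Cycle D (rot l)
  Cycle-rot (u , w , one , wu , un) = u , w , one , wu , un
  Cycle-rot (u , w , (_◂_ {l = l} e p) , wu , un) =
    _ , u , join p wu one , e , Unique-resp-↭ (↭-++-comm (u ∷ []) l) un

  Cycle-rots : ∀ i {l} → Cycle D l → Cycle D (rots i l)
  Cycle-rots zero c = c
  Cycle-rots (suc i) c = Cycle-rots i (Cycle-rot c)

  -- Counting, over all positions i of the cycle, the arcs z → cᵢ and cᵢ₊ₖ → z.
  bouquet : ∀ {l z} → Cycle D l → z ∉ l → length l < Σ[ adj D z ] l → ∀ k → k < length l →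
            (∀ {l'} → Cycle D l' → length l' ≡ suc (suc k) → ⊥) → ⊥
  bouquet {l} {z} cyc z∉ many k k< absent = <-irrefl refl (begin-strict
      L                                       <⟨ many ⟩
      Σ[ adj D z ] l                          ≡⟨ Σ-+ (ε D z) (λ v → ε D v z) l ⟩
      Σ[ ε D z ] l + Σ[ (λ v → ε D v z) ] l   ≡⟨ cong₂ _+_ (sym (full (ε D z) l)) (trans (sym (Σ-↭ _ (rots-↭ k l))) (sym (full (λ v → ε D v z) (rots k l)))) ⟩
      S[ (λ i → ε D z (hd z (rots i l))) ] L + S[ (λ i → ε D (hd z (rots i (rots k l))) z) ] (length (rots k l))
                                              ≡⟨ cong (λ t → S[ (λ i → ε D z (hd z (rots i l))) ] L + S[ (λ i → ε D (hd z (rots i (rots k l))) z) ] t) (↭-length (rots-↭ k l)) ⟩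
      S[ (λ i → ε D z (hd z (rots i l))) ] L + S[ (λ i → ε D (hd z (rots i (rots k l))) z) ] L
                                              ≤⟨ S-bound _ _ L (λ i → ε+ε≤1 D (through i)) ⟩
      L                                       ∎)
    where
    open ≤-Reasoning
    L = length l
    full : ∀ (f : Fin n → ℕ) m → S[ (λ i → f (hd z (rots i m))) ] (length m) ≡ Σ[ f ] m
    full f m = subst (λ m' → S[ (λ i → f (hd z (rots i m'))) ] (length m) ≡ Σ[ f ] m) (++-identityʳ m) (S-rots z f m [])
    -- Both arcs together would close `k + 1` consecutive cycle vertices and `z` to a cycle of
    -- length `k + 2`.
    through : ∀ i → Arc D z (hd z (rots i l)) → Arc D (hd z (rots i (rots k l))) z → ⊥
    through i zx yz with split-at k (rots i l) (≤-trans k< (≤-reflexive (sym (↭-length (rots-↭ i l)))))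
    ... | P , y , Q , e , eP with Cycle-rots i cyc
    ...   | u , w , p , _ , un = absent cycle' len
      where
      y≡ : hd z (rots i (rots k l)) ≡ y
      y≡ = cong (hd z) (trans (rots-swap i k l) (trans (cong (rots k) e) (trans (cong (λ j → rots j (P ++ y ∷ Q)) (sym eP)) (rots-++ P (y ∷ Q)))))
      p' : Path (Arc D) u (P ++ y ∷ []) y
      p' = proj₁ (splitPath P (subst (λ m → Path (Arc D) u m w) e p))
      u≡ : u ≡ hd z (rots i l)
      u≡ = head-hd p
        where
        head-hd : ∀ {u l w} → Path (Arc D) u l w → u ≡ hd z l
        head-hd one = refl
        head-hd (_ ◂ _) = refl
      sub : ∀ {t} → t ∈ P ++ y ∷ [] → t ∈ l
      sub {t} m = ∈-resp-↭ (rots-↭ i l) (subst (t ∈_) (sym (trans e (sym (++-assoc P (y ∷ []) Q)))) (∈-++⁺ˡ m))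
      cycle' : Cycle D (z ∷ P ++ y ∷ [])
      cycle' = z , y , subst (Arc D z) (sym u≡) zx ◂ p' , subst (λ t → Arc D t z) y≡ yz ,
        Unique-∷ (z∉ ∘ sub) (proj₁ (Unique-++⁻ (P ++ y ∷ []) (subst Unique (trans e (sym (++-assoc P (y ∷ []) Q))) un)))
      len : length (z ∷ P ++ y ∷ []) ≡ suc (suc k)
      len = cong suc (trans (length-++ P) (trans (+-comm (length P) 1) (cong suc eP)))

-- Semicomplete digraphs

Within : ∀ {n} → Digraph n → List (Fin n) → Set
Within D vs = ∀ {u w} → u ∈ vs → w ∈ vs → ∃ λ l → Path (Arc D) u l w × (∀ {v} → v ∈ l → v ∈ vs)

CycleIn : ∀ {n} → Digraph n → List (Fin n) → List (Fin n) → Set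
CycleIn D vs l = Cycle D l × (∀ {v} → v ∈ l → v ∈ vs)

firstCycle : ∀ {n} (D : Digraph n) {vs u u'} → Within D vs → u ∈ vs → u' ∈ vs → u ≢ u' →
             ∃ λ l → CycleIn D vs l × 2 ≤ length l
firstCycle D {vs} {u} strong u∈ u'∈ ne with strong u∈ u'∈
... | _ , one , _ = ⊥-elim (ne refl)
... | _ , (us ◂ p) , sub with strong (sub (there (first∈ p))) u∈
...   | l , q , sub' with simple q
...     | _ , one , _ = ⊥-elim (no-loop D us)
...     | l' , (e ◂ r) , un , sub'' = l' , ((_ , _ , (e ◂ r) , us , un) , sub' ∘ sub'') , s≤s (∈-length (last∈ r))

module Moon {n} (D : Digraph n) (vs : List (Fin n)) (unique : Unique vs) (strong : Within D vs)
    (complete : ∀ {u w} → u ∈ vs → w ∈ vs → u ≢ w → Arc D u w ⊎ Arc D w u) where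

  private
    V = Fin n

    -- An arc into `q` propagates along the path: `c → q` followed by `q → v` would be a place for
    -- inserting `q`.
    all-in : ∀ {c ρ a q} → Path (Arc D) c ρ a → (∀ {t} → t ∈ ρ → Arc D t q ⊎ Arc D q t) → ¬ Insertable D q ρ →
             Arc D c q → ∀ {t} → t ∈ ρ → Arc D t q
    all-in one h ni cq (here refl) = cq
    all-in (e ◂ p) h ni cq (here refl) = cq
    all-in {c} {q = q} (_◂_ {v = v} {l = l} e p) h ni cq (there m) = all-in p (h ∘ there)
      (λ { (r₁ , b , b' , r₂ , refl , x , y) → ni (c ∷ r₁ , b , b' , r₂ , refl , x , y) }) vq m
      where
      top : ∀ {l v w} → Path (Arc D) v l w → Arc D q v → Insertable D q (c ∷ l)
      top one qv = [] , _ , _ , _ , refl , cq , qv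
      top (_ ◂ _) qv = [] , _ , _ , _ , refl , cq , qv
      vq : Arc D v q
      vq with h (there (first∈ p))
      ... | inj₁ vq = vq
      ... | inj₂ qv = ⊥-elim (ni (top p qv))

    -- Vertices outside a cycle that cannot be enlarged by one dominate it or are dominated by it.
    module Grow {u l w} (p : Path (Arc D) u l w) (wu : Arc D w u) (un : Unique l) (sub : ∀ {v} → v ∈ l → v ∈ vs)
        (absent : ∀ {l'} → CycleIn D vs l' → length l' ≡ suc (length l) → ⊥) where

      add : ∀ {q l' } → q ∈ vs → q ∉ l → Cycle D l' → l' ↭ q ∷ l → ⊥
      add q∈ q∉ c perm = absent (c , λ m → in-vs (∈-resp-↭ perm m)) (↭-length perm)
        where
        in-vs : ∀ {t} → t ∈ _ ∷ l → t ∈ vs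
        in-vs (here refl) = q∈
        in-vs (there m) = sub m

      adjacent : ∀ {q t} → q ∈ vs → q ∉ l → t ∈ l → Arc D t q ⊎ Arc D q t
      adjacent q∈ q∉ t∈ = complete (sub t∈) q∈ (λ { refl → q∉ t∈ })

      Dominated : V → Set
      Dominated q = ∃ λ s → s ∈ l × Arc D s q

      dominated-all : ∀ {q} → q ∈ vs → q ∉ l → Dominated q → ∀ {t} → t ∈ l → Arc D t q
      dominated-all {q} q∈ q∉ (s , s∈ , sq) t∈ with rotateTo p wu s∈
      ... | l' , w' , p' , w's , perm = all-in p' (λ m → adjacent q∈ q∉ (∈-resp-↭ perm m)) ni sq (∈-resp-↭ (↭-sym perm) t∈)
        where
        ni : ¬ Insertable D q l'
        ni ins with insert D p' ins
        ... | l'' , p'' , perm' = add q∈ q∉ (s , w' , p'' , w's , Unique-resp-↭ (↭-sym whole) (Unique-∷ q∉ un)) whole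
          where
          whole : l'' ↭ q ∷ l
          whole = ↭-trans perm' (prep q perm)

      -- The predecessor of `t` on the cycle has an arc to `q`, so `q` would fit between the two.
      dominated-none : ∀ {q} → q ∈ vs → q ∉ l → Dominated q → ∀ {t} → t ∈ l → ¬ Arc D q t
      dominated-none {q} q∈ q∉ dom {t} t∈ qt with rotateTo p wu t∈
      ... | l' , w' , p' , w't , perm = add q∈ q∉
                (q , w' , qt ◂ p' , dominated-all q∈ q∉ dom (∈-resp-↭ perm (last∈ p')) ,
                 Unique-resp-↭ (↭-sym (prep q perm)) (Unique-∷ q∉ un)) (prep q perm)

      -- Every cycle vertex has an arc to `q` and one from `r`, so `q → r` can replace any single
      -- vertex; two for one gains exactly one. A cycle of length two becomes a triangle.
      bridge : ∀ {q r} → q ∈ vs → q ∉ l → Dominated q → r ∈ vs → r ∉ l → ¬ Dominated r → Arc D q r → ⊥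
      bridge {q} {r} q∈ q∉ dom r∈ r∉ ndom qr = replace p wu un refl
        where
        to : ∀ {t} → t ∈ l → Arc D r t
        to {t} t∈ with adjacent r∈ r∉ t∈
        ... | inj₁ tr = ⊥-elim (ndom (t , t∈ , tr))
        ... | inj₂ rt = rt
        q≢r : q ≢ r
        q≢r refl = ndom dom
        from : ∀ {t} → t ∈ l → Arc D t q
        from = dominated-all q∈ q∉ dom
        unique' : ∀ {u b m} → Unique (u ∷ b ∷ m) → u ∷ b ∷ m ≡ l → Unique (u ∷ q ∷ r ∷ m)
        unique' un refl = Unique-∷
          (∉-∷ (λ { refl → q∉ (here refl) }) (∉-∷ (λ { refl → r∉ (here refl) }) λ t∈ → Unique[x∷xs]⇒x∉xs un (there t∈)))
          (Unique-∷ (∉-∷ q≢r (q∉ ∘ there ∘ there)) (Unique-∷ (r∉ ∘ there ∘ there) (Unique-tail (Unique-tail un))))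
        sub' : ∀ {u b m} → u ∷ b ∷ m ≡ l → ∀ {t} → t ∈ u ∷ q ∷ r ∷ m → t ∈ vs
        sub' refl (here refl) = sub (here refl)
        sub' refl (there (here refl)) = q∈
        sub' refl (there (there (here refl))) = r∈
        sub' refl (there (there (there t∈))) = sub (there (there t∈))
        replace : ∀ {u m w} → Path (Arc D) u m w → Arc D w u → Unique m → m ≡ l → ⊥
        replace one wu un e = no-loop D wu
        replace (f ◂ one) wu un e = absent
          ((_ , r , from (subst (_ ∈_) e (here refl)) ◂ qr ◂ one , to (subst (_ ∈_) e (here refl)) , unique' un e) , sub' e)
          (cong (suc ∘ length) e)
        replace (f ◂ g ◂ p) wu un e = absent
          ((_ , _ , from (subst (_ ∈_) e (here refl)) ◂ qr ◂ to (subst (_ ∈_) e (there (there (first∈ p)))) ◂ p , wu , unique' un e) , sub' e)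
          (cong (suc ∘ length) e)

      from-dominated : ∀ {q m s} → q ∉ l → Dominated q → Path (Arc D) q m s → (∀ {v} → v ∈ m → v ∈ vs) → s ∉ l
      from-dominated q∉ dom one sub₁ = q∉
      from-dominated q∉ dom (_◂_ {v = v} e p) sub₁ s∈ with v ∈? l
      ... | yes v∈ = dominated-none (sub₁ (here refl)) q∉ dom v∈ e
      ... | no v∉ = by-cases {P = Dominated v} (λ d → from-dominated v∉ d p (sub₁ ∘ there) s∈)
                      (λ nd → bridge (sub₁ (here refl)) q∉ dom (sub₁ (there (first∈ p))) v∉ nd e)

      -- A vertex reached on leaving the cycle is dominated, and no path returns from there, against
      -- strong connectivity.
      leaving : ∀ {s m q} → s ∈ l → Path (Arc D) s m q → (∀ {v} → v ∈ m → v ∈ vs) → q ∈ l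
      leaving s∈ one sub₁ = s∈
      leaving {s} s∈ (_◂_ {v = v} e p) sub₁ with v ∈? l
      ... | yes v∈ = leaving v∈ p (sub₁ ∘ there)
      ... | no v∉ = ⊥-elim (back (strong (sub₁ (there (first∈ p))) (sub s∈)))
        where
        back : ∃ (λ m → Path (Arc D) v m s × (∀ {t} → t ∈ m → t ∈ vs)) → ⊥
        back (m , r , sub') = from-dominated v∉ (s , s∈ , e) r sub' s∈

      spanning : ∀ {q} → q ∈ vs → q ∈ l
      spanning q∈ with strong (sub (first∈ p)) q∈
      ... | m , r , sub₁ = leaving (first∈ p) r sub₁

    grow : ∀ {l} → CycleIn D vs l → length l < length vs →
           (∀ {l'} → CycleIn D vs l' → length l' ≡ suc (length l) → ⊥) → ⊥
    grow ((_ , _ , p , wu , un) , sub) lt absent = <⇒≱ lt (Unique-⊆-length unique (Grow.spanning p wu un sub absent))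

    growTo : ∀ k {l m} → CycleIn D vs l → m ≡ k + length l → m ≤ length vs →
             (∀ {l'} → CycleIn D vs l' → length l' ≡ m → ⊥) → ⊥
    growTo zero cyc e le absent = absent cyc (sym e)
    growTo (suc k) {l} {m} cyc e le absent = grow cyc (≤-trans (≤-trans (s≤s (m≤n+m (length l) k)) (≤-reflexive (sym e))) le)
      λ cyc' e' → growTo k cyc' (trans e (trans (sym (+-suc k (length l))) (cong (k +_) (sym e')))) le absent

    -- With `c` two steps after `u`, the arc `u → c` shortens the cycle by one vertex, while `c → u`
    -- closes a triangle.
    triangle : ∀ k {l} → CycleIn D vs l → length l ≡ 3 + k → ∃ λ l' → CycleIn D vs l' × length l' ≡ 3
    triangle zero cyc e = _ , cyc , e
    triangle (suc k) ((u , w , one , _) , _) ()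
    triangle (suc k) ((u , w , (_ ◂ one) , _) , _) ()
    triangle (suc k) ((u , w , (_◂_ {v = b} e (_◂_ {v = c} {l = m} f p)) , wu , un) , sub) len
      with complete (sub (here refl)) (sub (there (there (first∈ p)))) (λ { refl → Unique[x∷xs]⇒x∉xs un (there (first∈ p)) })
    ... | inj₁ uc = triangle k
          ((u , w , uc ◂ p , wu , Unique-∷ (λ t∈ → Unique[x∷xs]⇒x∉xs un (there t∈)) (Unique-tail (Unique-tail un))) ,
           λ { (here refl) → sub (here refl) ; (there t∈) → sub (there (there t∈)) }) (suc-injective len)
    ... | inj₂ cu = u ∷ b ∷ c ∷ [] ,
          ((u , c , e ◂ f ◂ one , cu ,
            Unique-∷ (∉-∷ (λ { refl → Unique[x∷xs]⇒x∉xs un (here refl) }) (λ { (here refl) → Unique[x∷xs]⇒x∉xs un (there (first∈ p)) }))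
              (Unique-∷ (λ { (here refl) → Unique[x∷xs]⇒x∉xs (Unique-tail un) (first∈ p) }) ([] ∷ []))) ,
           λ { (here refl) → sub (here refl) ; (there (here refl)) → sub (there (here refl))
             ; (there (there (here refl))) → sub (there (there (first∈ p))) }) , refl

  moon : ∀ {u u'} → u ∈ vs → u' ∈ vs → u ≢ u' → ∀ k → 3 + k ≤ length vs →
         (∀ {l} → CycleIn D vs l → length l ≡ 3 + k → ⊥) → ⊥
  moon u∈ u'∈ ne k le absent with firstCycle D strong u∈ u'∈ ne
  ... | l , cyc , 2≤ with length l in eq | 2≤
  ...   | suc zero | s≤s ()
  ...   | suc (suc zero) | _ = growTo (suc k) cyc (trans (+-comm 2 (suc k)) (cong (suc k +_) (sym eq))) le absent
  ...   | suc (suc (suc j)) | _ with triangle j cyc eq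
  ...     | l' , cyc' , e = growTo k cyc' (trans (+-comm 3 k) (cong (k +_) (sym e))) le absent

-- Pancyclicity

fresh : ∀ {n} (l : List (Fin n)) → length l < n → ∃ λ v → v ∉ l
fresh {n} l lt with anyFin? (λ v → ¬? (v ∈? l))
... | yes p = p
... | no ¬p = ⊥-elim (<⇒≱ lt (≤-trans (≤-reflexive (sym (length-tabulate {n = n} id))) (Unique-⊆-length (Unique-allFin⁺ n) all)))
  where
  all : ∀ {v} → v ∈ allFin n → v ∈ l
  all {v} _ with v ∈? l
  ... | yes m = m
  ... | no m = ⊥-elim (¬p (v , m))

deg-Σ : ∀ {n} (D : Digraph n) v → deg D v ≡ Σ[ adj D v ] (allFin n)
deg-Σ {n} D v = sym (Σ-+ (ε D v) (λ w → ε D w v) (allFin n))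

-- Walks and connections from the hypotheses

reachPath : ∀ {n} {D : Digraph n} {v u w} → Reach D v u w → u ≢ v → ∃ λ l → Path (Arc D) u l w × v ∉ l
reachPath Reach.here ne = _ , one , λ { (here e) → ne (sym e) }
reachPath (step e ne' r) ne with reachPath r ne'
... | l , p , v∉ = _ , e ◂ p , ∉-∷ (ne ∘ sym) v∉

module _ {n} {D : Digraph n} {x y v : Fin n} (y↛x : ¬ Arc D y x) (y≢x : y ≢ x) where

  private
    -- The walk is used from its last visit to `y` before it reaches `x`: on each return to `y` the
    -- collected part is discarded.
    run : ∀ {u l c} → Arc D y u → Path (InnerArc D x y) u l c → v ∉ l → Inner x y c → Reach D v c x →
          ∃ λ l' → Via D x y y x l' × v ∉ l'
    restart : Reach D v y x → ∃ λ l' → Via D x y y x l' × v ∉ l'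

    run yu p v∉ (c≢x , _) Reach.here = ⊥-elim (c≢x refl)
    run {l = l} yu p v∉ ic (step {y = d} cd d≢v r) with d ≟ x | d ≟ y
    ... | yes refl | _ = l , (_ , _ , yu , cd , p) , v∉
    ... | no _ | yes refl = restart r
    ... | no d≢x | no d≢y = run yu (join p (cd , ic , (d≢x , d≢y)) one)
            (∉-++ l v∉ λ { (here e) → d≢v (sym e) }) (d≢x , d≢y) r

    restart Reach.here = ⊥-elim (y≢x refl)
    restart (step {y = d} yd d≢v r) with d ≟ x | d ≟ y
    ... | yes refl | _ = ⊥-elim (y↛x yd)
    ... | no _ | yes refl = ⊥-elim (no-loop D yd)
    ... | no d≢x | no d≢y = run yd one (λ { (here e) → d≢v (sym e) }) (d≢x , d≢y) r

  viaWalk : Reach D v y x → ∃ λ l' → Via D x y y x l' × v ∉ l'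
  viaWalk = restart

via-inner : ∀ {n} {D : Digraph n} {x y s t l} → (∀ {u} → Arc D s u → Inner x y u) → Via D x y s t l →
            ∀ {v} → v ∈ l → Inner x y v
via-inner {D = D} {x} {y} out (_ , _ , su , _ , p) = all-inner p (out su)
  where
  all-inner : ∀ {u l w} → Path (InnerArc D x y) u l w → Inner x y u → ∀ {t} → t ∈ l → Inner x y t
  all-inner one iu (here refl) = iu
  all-inner (_ ◂ _) iu (here refl) = iu
  all-inner ((_ , _ , iv) ◂ p) iu (there m) = all-inner p iv m

avoidingWalk : ∀ {n} {D : Digraph n} {x y} → TwoStrong D → ¬ Arc D y x → y ≢ x → ∀ p → ∃ λ l → Via D x y y x l × p ∉ l
avoidingWalk {n} {D} {x} {y} (3≤n , strong) y↛x y≢x p = avoid (p ≟ x) (p ≟ y)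
  where
  avoiding : ∀ v → v ≢ x → v ≢ y → ∃ λ l → Via D x y y x l × v ∉ l
  avoiding v v≢x v≢y = viaWalk y↛x y≢x (strong v y x (v≢y ∘ sym) (v≢x ∘ sym))
  -- For `p` equal to `x` or `y` a third vertex is deleted instead; inner walks avoid both ends
  -- anyway.
  inner-walk : ∃ λ l → Via D x y y x l × (∀ {v} → v ∈ l → Inner x y v)
  inner-walk with fresh (x ∷ y ∷ []) 3≤n
  ... | v , v∉ with avoiding v (λ e → v∉ (here e)) (λ e → v∉ (there (here e)))
  ...   | l , w , _ = l , w , via-inner {D = D} {t = x} (λ yu → (λ { refl → y↛x yu }) , λ { refl → no-loop D yu }) w
  avoid : Dec (p ≡ x) → Dec (p ≡ y) → ∃ λ l → Via D x y y x l × p ∉ l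
  avoid (no p≢x) (no p≢y) = avoiding p p≢x p≢y
  avoid (yes e) _ = let l , w , inner = inner-walk in l , w , λ m → proj₁ (inner m) e
  avoid (no _) (yes e) = let l , w , inner = inner-walk in l , w , λ m → proj₂ (inner m) e

module _ {n} (D : Digraph n) where

  private
    χ : List (Fin n) → Fin n → ℕ
    χ l v with v ∈? l
    ... | yes _ = 1
    ... | no _ = 0

    χ-∈ : ∀ {l v} → v ∈ l → χ l v ≡ 1
    χ-∈ {l} {v} m with v ∈? l
    ... | yes _ = refl
    ... | no ¬m = ⊥-elim (¬m m)

    Σχ-filter : ∀ fs l → Σ[ χ fs ] l ≡ length (filter (_∈? fs) l)
    Σχ-filter fs [] = refl
    Σχ-filter fs (v ∷ l) with v ∈? fs
    ... | yes _ = cong suc (Σχ-filter fs l)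
    ... | no _ = Σχ-filter fs l

    Σχ≤ : ∀ fs {l} → Unique l → Σ[ χ fs ] l ≤ length fs
    Σχ≤ fs {l} un = ≤-trans (≤-reflexive (Σχ-filter fs l))
      (Unique-⊆-length (Unique-filter⁺ (_∈? fs) un) (λ m → proj₂ (∈-filter⁻ (_∈? fs) {xs = l} m)))

    ε+ε≤1+χ : ∀ {a b c d w} fs → (Arc D a b → Arc D c d → w ∈ fs) → ε D a b + ε D c d ≤ 1 + χ fs w
    ε+ε≤1+χ {a} {b} {c} {d} {w} fs h with arc? D a b | arc? D c d
    ... | yes p | yes q = ≤-trans (+-mono-≤ (ε≤1 D a b) (ε≤1 D c d)) (≤-reflexive (cong suc (sym (χ-∈ (h p q)))))
    ... | no p | _ rewrite ε≡0 D p = ≤-trans (ε≤1 D c d) (s≤s z≤n)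
    ... | yes _ | no q rewrite ε≡0 D q | +-identityʳ (ε D a b) = ≤-trans (ε≤1 D a b) (s≤s z≤n)

  -- Pairing `y → w` with `w → z` and `z → w` with `w → y` bounds the degree sum by 2(n - 2) plus
  -- the number of connections; the value 2n + 1 forces five.
  wellConnected : ∀ {y z} → z ≢ y → ¬ Arc D y z → ¬ Arc D z y → 2 * n + 1 ≤ deg D y + deg D z → WellConnected D y z
  wellConnected {y} {z} z≢y y↛z z↛y big fs gs le F G with pull (∈-allFin y)
  ... | r₁ , perm₁ with pull (z∈ perm₁)
    where
    z∈ : ∀ {r₁} → allFin n ↭ y ∷ r₁ → z ∈ r₁
    z∈ perm with ∈-resp-↭ perm (∈-allFin z)
    ... | here e = ⊥-elim (z≢y e)
    ... | there m = m
  ...   | r , perm₂ = <⇒≱ (≤-trans (≤-reflexive (+-comm 1 (2 * n))) big) (begin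
      deg D y + deg D z                         ≡⟨ cong₂ _+_ (deg-Σ D y) (deg-Σ D z) ⟩
      Σ[ adj D y ] (allFin n) + Σ[ adj D z ] (allFin n) ≡⟨ sym (Σ-+ (adj D y) (adj D z) (allFin n)) ⟩
      Σ[ f ] (allFin n)                         ≡⟨ Σ-↭ f perm ⟩
      f y + (f z + Σ[ f ] r)                    ≡⟨ cong₂ (λ a b → a + (b + Σ[ f ] r)) (cong₂ _+_ (adj-self D y) (adj≡0 D z↛y y↛z)) (cong₂ _+_ (adj≡0 D y↛z z↛y) (adj-self D z)) ⟩
      Σ[ f ] r                                  ≤⟨ Σ-mono f g r (λ {w} _ → per w) ⟩
      Σ[ g ] r                                  ≡⟨ trans (Σ-+ (λ w → 2) (λ w → χ fs w + χ gs w) r) (cong₂ _+_ (Σ-const 2 r) (Σ-+ (χ fs) (χ gs) r)) ⟩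
      length r * 2 + (Σ[ χ fs ] r + Σ[ χ gs ] r) ≤⟨ +-monoʳ-≤ (length r * 2) (≤-trans (+-mono-≤ (Σχ≤ fs un) (Σχ≤ gs un)) le) ⟩
      length r * 2 + 4                          ≡⟨ solve 1 (λ a → a :* con 2 :+ con 4 := con 2 :* (con 2 :+ a)) refl (length r) ⟩
      2 * (2 + length r)                        ≡⟨ cong (2 *_) (trans (sym (↭-length perm)) (length-tabulate {n = n} id)) ⟩
      2 * n                                     ∎)
    where
    open +-*-Solver
    open ≤-Reasoning
    f g : Fin n → ℕ
    f w = adj D y w + adj D z w
    g w = 2 + (χ fs w + χ gs w)
    perm : allFin n ↭ y ∷ z ∷ r
    perm = ↭-trans perm₁ (prep y perm₂)
    un : Unique r
    un = Unique-tail (Unique-tail (Unique-resp-↭ perm (Unique-allFin⁺ n)))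
    per : ∀ w → f w ≤ g w
    per w = ≤-trans
      (≤-reflexive (solve 4 (λ a b c d → (a :+ b) :+ (c :+ d) := (a :+ d) :+ (c :+ b)) refl (ε D y w) (ε D w y) (ε D z w) (ε D w z)))
      (≤-trans (+-mono-≤ (ε+ε≤1+χ {w = w} fs (F w)) (ε+ε≤1+χ {w = w} gs (G w)))
        (≤-reflexive (solve 2 (λ a b → (con 1 :+ a) :+ (con 1 :+ b) := con 2 :+ (a :+ b)) refl (χ fs w) (χ gs w))))

-- The three constructions of cycles

module Main (n : ℕ) (D : Digraph n) (ts : TwoStrong D) (6≤n : 6 ≤ n) (x y : Fin n) (nonadj : NonAdjacent D x y)
    (rest : ∀ {u w} → NonAdjacent D u w → ¬ ((x ≡ u × y ≡ w) ⊎ (x ≡ w × y ≡ u)) → 2 * n + 1 ≤ deg D u + deg D w) where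

  private
    V = Fin n
    x≢y = proj₁ nonadj
    x↛y = proj₁ (proj₂ nonadj)
    y↛x = proj₂ (proj₂ nonadj)

    length-allFin : length (allFin n) ≡ n
    length-allFin = length-tabulate id

    strongAll : Within D (allFin n)
    strongAll {u} {w} _ _ with fresh (u ∷ w ∷ []) (≤-trans (s≤s (s≤s (s≤s z≤n))) 6≤n)
    ... | v , v∉ with reachPath (proj₂ ts v u w (λ { refl → v∉ (here refl) }) (λ { refl → v∉ (there (here refl)) })) (λ { refl → v∉ (here refl) })
    ...   | l , p , _ = l , p , λ _ → ∈-allFin _

    without : ∀ z → ∃ λ vs → allFin n ↭ z ∷ vs
    without z = pull (∈-allFin z)

    module Without (z : V) where
      vs = proj₁ (without z)
      perm = proj₂ (without z)
      unique' : Unique (z ∷ vs)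
      unique' = Unique-resp-↭ perm (Unique-allFin⁺ n)
      unique : Unique vs
      unique = Unique-tail unique'
      size : suc (length vs) ≡ n
      size = trans (sym (↭-length perm)) length-allFin
      ∈⇒≢ : ∀ {v} → v ∈ vs → v ≢ z
      ∈⇒≢ m refl = Unique[x∷xs]⇒x∉xs unique' m
      ≢⇒∈ : ∀ {v} → v ≢ z → v ∈ vs
      ≢⇒∈ {v} ne with ∈-resp-↭ perm (∈-allFin v)
      ... | here e = ⊥-elim (ne e)
      ... | there m = m
      strong : Within D vs
      strong {u} {w} u∈ w∈ with reachPath (proj₂ ts z u w (∈⇒≢ u∈) (∈⇒≢ w∈)) (∈⇒≢ u∈)
      ... | l , p , z∉ = l , p , λ m → ≢⇒∈ (λ { refl → z∉ m })
      deg≡ : ∀ v → deg D v ≡ adj D v z + Σ[ adj D v ] vs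
      deg≡ v = trans (deg-Σ D v) (Σ-↭ (adj D v) perm)
      pair : ∃ λ u → ∃ λ w → u ∈ vs × w ∈ vs × u ≢ w
      pair with fresh (z ∷ []) (≤-trans (s≤s (s≤s z≤n)) 6≤n)
      ... | u , u∉ with fresh (u ∷ z ∷ []) (≤-trans (s≤s (s≤s (s≤s z≤n))) 6≤n)
      ...   | w , w∉ = u , w , ≢⇒∈ (λ e → u∉ (here e)) , ≢⇒∈ (λ e → w∉ (there (here e))) , λ e → w∉ (here (sym e))

  heavyVertex : ∀ {z} → suc n ≤ deg D z → ∀ k → 3 + k ≤ n → (∀ {l} → Cycle D l → length l ≡ suc (suc k) → ⊥) → ⊥
  heavyVertex {z} heavy k le absent with Without.pair z
  ... | u₀ , w₀ , u₀∈ , w₀∈ , ne with firstCycle D (Without.strong z) u₀∈ w₀∈ ne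
  ...   | l₀ , ((u , w , p , wu , un) , sub) , _ =
      Cover.cover D vs unique strong (λ v → v ≢ x) (λ v → ¬? (v ≟ x)) only (λ _ → ⊥) (λ ()) dense covered
        (suc (length vs)) (m≤m+n _ _) p wu un sub (λ ())
    where
    open Without z
    only : ∀ {q q'} → ¬ (q ≢ x) → ¬ (q' ≢ x) → q ≡ q'
    only {q} {q'} a b with q ≟ x | q' ≟ x
    ... | yes e | yes e' = trans e (sym e')
    ... | no ne | _ = ⊥-elim (a ne)
    ... | _ | no ne = ⊥-elim (b ne)
    dense : ∀ {u s} → u ∈ vs → s ∈ vs → u ≢ x → s ≢ x → (⊥ → ⊥) → u ≢ s → ¬ Arc D u s → ¬ Arc D s u →
            2 * length vs ≤ Σ[ adj D u ] vs + Σ[ adj D s ] vs + 1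
    -- Losing `z` costs the pair at most four arcs, and 2n + 1 - 4 = 2(n - 1) - 1. This is the
    -- origin of the `+ 1` in the density hypotheses.
    dense {u} {s} _ _ u≢x s≢x _ u≢s us su = s≤s⁻¹ (s≤s⁻¹ (s≤s⁻¹ (begin
        3 + 2 * length vs                                           ≡⟨ solve 1 (λ a → con 3 :+ con 2 :* a := con 2 :* (con 1 :+ a) :+ con 1) refl (length vs) ⟩
        2 * suc (length vs) + 1                                     ≡⟨ cong (λ t → 2 * t + 1) size ⟩
        2 * n + 1                                                   ≤⟨ rest (u≢s , us , su) (λ { (inj₁ (e , _)) → u≢x (sym e) ; (inj₂ (e , _)) → s≢x (sym e) }) ⟩
        deg D u + deg D s                                           ≡⟨ cong₂ _+_ (deg≡ u) (deg≡ s) ⟩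
        (adj D u z + Σ[ adj D u ] vs) + (adj D s z + Σ[ adj D s ] vs) ≤⟨ +-mono-≤ (+-monoˡ-≤ (Σ[ adj D u ] vs) (adj≤2 D u z)) (+-monoˡ-≤ (Σ[ adj D s ] vs) (adj≤2 D s z)) ⟩
        (2 + Σ[ adj D u ] vs) + (2 + Σ[ adj D s ] vs)               ≡⟨ solve 2 (λ a b → (con 2 :+ a) :+ (con 2 :+ b) := con 3 :+ (a :+ b :+ con 1)) refl (Σ[ adj D u ] vs) (Σ[ adj D s ] vs) ⟩
        3 + (Σ[ adj D u ] vs + Σ[ adj D s ] vs + 1)                 ∎)))
      where
      open +-*-Solver
      open ≤-Reasoning
    covered : ∀ {u l w} → Path (Arc D) u l w → Arc D w u → Unique l → (∀ {v} → v ∈ l → v ∈ vs) →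
              (∀ {v} → v ∈ vs → v ≢ x → v ∈ l) → ⊥
    covered {u} {l} {w} p wu un sub all with complement un sub
    ... | ω , perm' = bouquet D (u , w , p , wu , un) (λ m → ∈⇒≢ (sub m) refl) many k k< absent
      where
      open +-*-Solver
      open ≤-Reasoning
      unω : Unique (l ++ ω)
      unω = Unique-resp-↭ (↭-sym perm') unique
      ω⊆ : ∀ {v} → v ∈ ω → v ∈ x ∷ []
      ω⊆ {v} m with v ≟ x
      ... | yes e = here e
      ... | no ne = ⊥-elim (proj₂ (proj₂ (Unique-++⁻ l unω)) (all (∈-resp-↭ perm' (∈-++⁺ʳ l m)) ne) m)
      ω≤1 : length ω ≤ 1
      ω≤1 = Unique-⊆-length (proj₁ (proj₂ (Unique-++⁻ l unω))) ω⊆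
      size' : n ≡ suc (length l + length ω)
      size' = trans (sym size) (cong suc (trans (sym (↭-length perm')) (length-++ l)))
      deg-z : deg D z ≡ Σ[ adj D z ] l + Σ[ adj D z ] ω
      deg-z = trans (deg≡ z) (trans (cong (_+ Σ[ adj D z ] vs) (adj-self D z)) (trans (sym (Σ-↭ (adj D z) perm')) (Σ-++ (adj D z) l ω)))
      -- As `ω` contains at most `x`, it takes at most |ω| + 1 of the at least n + 1 arcs at `z`,
      -- leaving n - |ω| = |l| + 1.
      many : length l < Σ[ adj D z ] l
      many = +-cancelʳ-≤ (length ω + 1) _ _ (begin
        suc (length l) + (length ω + 1)             ≡⟨ solve 2 (λ a b → con 1 :+ a :+ (b :+ con 1) := con 1 :+ (con 1 :+ (a :+ b))) refl (length l) (length ω) ⟩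
        suc (suc (length l + length ω))             ≡⟨ cong suc (sym size') ⟩
        suc n                                       ≤⟨ heavy ⟩
        deg D z                                     ≡⟨ deg-z ⟩
        Σ[ adj D z ] l + Σ[ adj D z ] ω             ≤⟨ +-monoʳ-≤ (Σ[ adj D z ] l) (Σ-bound (adj D z) 2 ω (λ {v} _ → adj≤2 D z v)) ⟩
        Σ[ adj D z ] l + length ω * 2               ≡⟨ cong (Σ[ adj D z ] l +_) (solve 1 (λ a → a :* con 2 := a :+ a) refl (length ω)) ⟩
        Σ[ adj D z ] l + (length ω + length ω)      ≤⟨ +-monoʳ-≤ (Σ[ adj D z ] l) (+-monoʳ-≤ (length ω) ω≤1) ⟩
        Σ[ adj D z ] l + (length ω + 1)             ∎)
      k< : k < length l
      k< = s≤s⁻¹ (s≤s⁻¹ (begin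
        3 + k                             ≤⟨ le ⟩
        n                                 ≡⟨ size' ⟩
        suc (length l + length ω)         ≤⟨ s≤s (+-monoʳ-≤ (length l) ω≤1) ⟩
        suc (length l + 1)                ≡⟨ cong suc (+-comm (length l) 1) ⟩
        2 + length l                      ∎))

  semicomplete : (∀ {u w} → NonAdjacent D u w → ¬ ((x ≡ u × y ≡ w) ⊎ (x ≡ w × y ≡ u)) → ⊥) →
                 ∀ k → 4 + k ≤ n → (∀ {l} → Cycle D l → length l ≡ 3 + k → ⊥) → ⊥
  semicomplete none' k le absent with Without.pair x
  ... | u₀ , w₀ , u₀∈ , w₀∈ , ne = Moon.moon D vs unique strong complete u₀∈ w₀∈ ne k
        (s≤s⁻¹ (≤-trans le (≤-reflexive (sym size)))) (λ c → absent (proj₁ c))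
    where
    open Without x
    complete : ∀ {u w} → u ∈ vs → w ∈ vs → u ≢ w → Arc D u w ⊎ Arc D w u
    complete {u} {w} u∈ w∈ u≢w with arc? D u w | arc? D w u
    ... | yes a | _ = inj₁ a
    ... | no _ | yes a = inj₂ a
    ... | no a | no b = ⊥-elim (none' (u≢w , a , b) λ { (inj₁ (e , _)) → ∈⇒≢ u∈ (sym e) ; (inj₂ (e , _)) → ∈⇒≢ w∈ (sym e) })

  through-xy : ∀ {u l w} → Path (Arc D) u l w → Arc D w u → Unique l → x ∈ l → y ∈ l →
               (∀ {l'} → Cycle D l' → length l' ≡ n → ⊥) → ⊥
  through-xy p wu un x∈ y∈ absent = Cover.cover D (allFin n) (Unique-allFin⁺ n) strongAll (λ _ → ⊤) (λ _ → yes tt)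
      (λ a → ⊥-elim (a tt)) (λ v → v ≡ x ⊎ v ≡ y) (λ _ → tt) dense covered (suc (length (allFin n))) (m≤m+n _ _)
      p wu un (λ _ → ∈-allFin _) (λ { (inj₁ refl) → x∈ ; (inj₂ refl) → y∈ })
    where
    dense : ∀ {u s} → u ∈ allFin n → s ∈ allFin n → ⊤ → ⊤ → ¬ (u ≡ x ⊎ u ≡ y) → u ≢ s → ¬ Arc D u s → ¬ Arc D s u →
            2 * length (allFin n) ≤ Σ[ adj D u ] (allFin n) + Σ[ adj D s ] (allFin n) + 1
    dense {u} {s} _ _ _ _ u∉ u≢s us su rewrite sym (deg-Σ D u) | sym (deg-Σ D s) | length-allFin =
      ≤-trans (m≤m+n (2 * n) 1) (≤-trans (rest (u≢s , us , su) λ { (inj₁ (e , _)) → u∉ (inj₁ (sym e)) ; (inj₂ (_ , e)) → u∉ (inj₂ (sym e)) }) (m≤m+n _ 1))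
    covered : ∀ {u l w} → Path (Arc D) u l w → Arc D w u → Unique l → (∀ {v} → v ∈ l → v ∈ allFin n) →
              (∀ {v} → v ∈ allFin n → ⊤ → v ∈ l) → ⊥
    covered p wu un sub all = absent (_ , _ , p , wu , un)
      (≤-antisym (≤-trans (Unique-⊆-length un sub) (≤-reflexive length-allFin))
                 (≤-trans (≤-reflexive (sym length-allFin)) (Unique-⊆-length (Unique-allFin⁺ n) (λ m → all m tt))))

  hamiltonian : (∀ {l} → Cycle D l → length l ≡ n → ⊥) → ⊥
  hamiltonian absent = linked setup
    where
    xy : ∀ p → ∃ λ l → Via D x y x y l × p ∉ l
    xy p = let l , w , p∉ = avoidingWalk {D = D} ts x↛y x≢y p in l , swapVia {D = D} w , p∉
    setup : Setup D x y
    setup = record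
      { x↛y = x↛y ; y↛x = y↛x ; walk-yx = avoidingWalk ts y↛x (x≢y ∘ sym) ; walk-xy = xy
      ; conn-x = λ { {z} (z≢x , z≢y) a b → wellConnected D z≢x a b
          (rest ((z≢x ∘ sym) , a , b) λ { (inj₁ (_ , e)) → z≢y (sym e) ; (inj₂ (e , _)) → z≢x (sym e) }) }
      ; conn-y = λ { {z} (z≢x , z≢y) a b → wellConnected D z≢y a b
          (rest ((z≢y ∘ sym) , a , b) λ { (inj₁ (e , _)) → x≢y e ; (inj₂ (e , _)) → z≢x (sym e) }) }
      ; unlinked = close }
      where
      close : ∀ {l₁ l₂} → Via D x y x y l₁ → Via D x y y x l₂ → Disj l₁ l₂ → ⊥
      close v₁@(u₁ , w₁ , xu₁ , w₁y , p₁) v₂@(u₂ , w₂ , yu₂ , w₂x , p₂) dj with simple p₁ | simple p₂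
      ... | Q₁ , q₁ , un₁ , s₁ | Q₂ , q₂ , un₂ , s₂ =
        through-xy (xu₁ ◂ join (mapPath proj₁ q₁) w₁y (yu₂ ◂ mapPath proj₁ q₂)) w₂x
          (Unique-∷ (∉-++ Q₁ (λ m → proj₁ (in₁ m) refl) (∉-∷ x≢y (λ m → proj₁ (in₂ m) refl)))
            (Unique-++⁺ un₁ (Unique-∷ (λ m → proj₂ (in₂ m) refl) un₂)
              λ { (m , here refl) → proj₂ (in₁ m) refl ; (m , there m') → dj (s₁ m) (s₂ m') }))
          (here refl) (there (∈-insert Q₁)) absent
        where
        in₁ : ∀ {v} → v ∈ Q₁ → Inner x y v
        in₁ m = via-inner {D = D} {t = y} (λ xu → (λ { refl → no-loop D xu }) , λ { refl → x↛y xu }) v₁ (s₁ m)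
        in₂ : ∀ {v} → v ∈ Q₂ → Inner x y v
        in₂ m = via-inner {D = D} {t = x} (λ yu → (λ { refl → y↛x yu }) , λ { refl → no-loop D yu }) v₂ (s₂ m)

theorem1p16 : ∀ (n : ℕ) (D : Digraph n) → TwoStrong D → 6 ≤ n
    → (∀ (x y w z : Fin n) → NonAdjacent D x y → NonAdjacent D w z
    → ¬ ((x ≡ w × y ≡ z) ⊎ (x ≡ z × y ≡ w))
    → 4 * n ∸ 3 ≤ deg D x + deg D y + deg D w + deg D z)
    → (Σ (Fin n) λ x → Σ (Fin n) λ y → NonAdjacent D x y × deg D x + deg D y ≤ 2 * n ∸ 4)
    → Pancyclic D
theorem1p16 n D ts 6≤n sums (x , y , nonadj , low) (suc (suc (suc k))) (s≤s (s≤s (s≤s z≤n))) m≤n =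
  hasCycle-stable D (3 + k) λ noCycle →
    let absent : ∀ {l} → Cycle D l → length l ≡ 3 + k → ⊥
        absent c e = noCycle (subst (HasCycle D) e (hasCycle D c))
    in lengths absent (m≤n⇒m<n∨m≡n m≤n)
  where
  rest : ∀ {u w} → NonAdjacent D u w → ¬ ((x ≡ u × y ≡ w) ⊎ (x ≡ w × y ≡ u)) → 2 * n + 1 ≤ deg D u + deg D w
  rest {u} {w} nu ns = +-cancelˡ-≤ (2 * n) _ _ (begin
      2 * n + (2 * n + 1)                                     ≡⟨ solve 1 (λ n → con 2 :* n :+ (con 2 :* n :+ con 1) := con 4 :* n :+ con 1) refl n ⟩
      4 * n + 1                                               ≤⟨ +-monoˡ-≤ 1 (m≤n+m∸n (4 * n) 3) ⟩
      3 + (4 * n ∸ 3) + 1                                     ≤⟨ +-monoˡ-≤ 1 (+-monoʳ-≤ 3 (sums x y u w nonadj nu ns)) ⟩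
      3 + (deg D x + deg D y + deg D u + deg D w) + 1         ≡⟨ solve 3 (λ a b c → con 3 :+ (a :+ b :+ c) :+ con 1 := (a :+ con 4) :+ (b :+ c)) refl (deg D x + deg D y) (deg D u) (deg D w) ⟩
      (deg D x + deg D y + 4) + (deg D u + deg D w)           ≤⟨ +-monoˡ-≤ _ (+-monoˡ-≤ 4 low) ⟩
      -- `6≤n` guarantees that `2 * n ∸ 4` is not truncated.
      (2 * n ∸ 4 + 4) + (deg D u + deg D w)                   ≡⟨ cong (_+ (deg D u + deg D w)) (m∸n+n≡m (≤-trans (≤-trans (s≤s (s≤s (s≤s (s≤s z≤n)))) 6≤n) (m≤m+n n _))) ⟩
      2 * n + (deg D u + deg D w)                             ∎)
    where
    open +-*-Solver
    open ≤-Reasoning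
  open Main n D ts 6≤n x y nonadj rest
  lengths : (∀ {l} → Cycle D l → length l ≡ 3 + k → ⊥) → 3 + k < n ⊎ 3 + k ≡ n → ⊥
  lengths absent (inj₂ refl) = hamiltonian absent
  lengths absent (inj₁ lt) = semicomplete
    (λ {u} {w} nu ns → heavy (rest nu ns)) k lt absent
    where
    heavy : ∀ {u w} → 2 * n + 1 ≤ deg D u + deg D w → ⊥
    heavy {u} {w} big with suc n ≤? deg D u | suc n ≤? deg D w
    -- `heavyVertex` produces length `k + 2` from its argument `k`, hence `suc k` for length
    -- `3 + k`.
    ... | yes h | _ = heavyVertex h (suc k) lt absent
    ... | no _ | yes h = heavyVertex h (suc k) lt absent
    ... | no a | no b = <⇒≱ (≤-trans (≤-reflexive (+-comm 1 (2 * n))) big)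
      (≤-trans (+-mono-≤ (s≤s⁻¹ (≰⇒> a)) (s≤s⁻¹ (≰⇒> b))) (≤-reflexive (cong (n +_) (sym (+-identityʳ n)))))
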